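{- There exists a function $\alpha = \alpha(k) > 0$ with $\alpha(k) \to 0$ as $k \to \infty$ such that for every fixed integer $k \geq 2$ and every sufficiently large integer $n$ the following holds. If $q \geq (4 + \alpha) n/(k\log k)$ is an integer, then in the $(1:q)$ Client-Waiter game played on $E(K_n)$, Waiter has a strategy to ensure that Client's graph is $k$-colorable. On the other hand, if $q \leq (\log 2/2 - \alpha) n/(k \log k)$ is a positive integer, then in the $(1:q)$ Client-Waiter game played on $E(K_n)$, Client has a strategy to build a non-$k$-colorable graph.
   Context: $\log$ denotes the natural logarithm. The $(1:q)$ Client-Waiter game on the board $E(K_n)$ is played as follows: in each round Waiter offers Client some number $s$ of previously unoffered (free) edges with $1 \le s \le q+1$ (if fewer free edges remain, he offers at most those); Client claims one of the offered edges and Waiter claims the remaining $s-1$. The game ends when all edges are claimed. Client's graph is the graph on $V(K_n)$ formed by the edges Client claimed. -}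

module Defs where

open import Data.Nat as ℕ using (ℕ; zero; suc; _+_; _*_; _^_; _≤_; pred)
open import Data.Integer as ℤ using (ℤ; +_)
open import Data.Rational.Unnormalised as Q using (ℚᵘ; mkℚᵘ; 0ℚᵘ; ∣_∣)
open import Data.Fin using (Fin; toℕ)
open import Data.Fin.Properties using () renaming (_≟_ to _≟ᶠ_)
open import Data.List using (List; []; _∷_; length; filter; allFin; concatMap; map)
open import Data.List.Relation.Unary.All using (All)
open import Data.List.Relation.Unary.Unique.Propositional using (Unique)
open import Data.List.Membership.Propositional using (_∈_)
open import Data.List.Membership.DecPropositional using () renaming (_∈?_ to mem?)
open import Data.Product using (Σ; ∃; _×_; _,_)
open import Data.Product.Properties using (≡-dec)
open import Relation.Binary.PropositionalEquality using (_≡_; _≢_)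
open import Relation.Nullary using (¬_; ¬?)
open import Relation.Binary.Definitions using (DecidableEquality)
open import Data.Nat.Properties using (_<?_)

-- Natural logarithm of a positive rational a/b, via the everywhere
-- convergent series  log(a/b) = 2 Σ_{j≥0} y^(2j+1)/(2j+1),
-- y = (a-b)/(a+b) ∈ (-1,1)  (a,b ≥ 1), with the explicit error bound
-- |log(a/b) - S_N| ≤ E_N := 2|y|^(2N+1)/(1-y²) = (a+b)²/(2ab)·|y|^(2N+1).
-- U_N := S_N + E_N is thus an upper bound of log(a/b) tending to it.

powQ : ℚᵘ → ℕ → ℚᵘ
powQ x zero = Q.1ℚᵘ
powQ x (suc m) = x Q.* powQ x m

-- y = (a - b)/(a + b)   (meaningful for a + b ≥ 1)
logY : ℕ → ℕ → ℚᵘ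
logY a b = mkℚᵘ (+ a ℤ.- + b) (pred (a + b))

logTerm : ℕ → ℕ → ℕ → ℚᵘ
logTerm a b j = mkℚᵘ (+ 2) (2 * j) Q.* powQ (logY a b) (suc (2 * j))

logS : ℕ → ℕ → ℕ → ℚᵘ
logS a b zero = 0ℚᵘ
logS a b (suc N) = logS a b N Q.+ logTerm a b N

-- error bound E_N (meaningful for a, b ≥ 1)
logE : ℕ → ℕ → ℕ → ℚᵘ
logE a b N = mkℚᵘ (+ ((a + b) ^ 2)) (pred (2 * a * b)) Q.* powQ ∣ logY a b ∣ (suc (2 * N))

logU : ℕ → ℕ → ℕ → ℚᵘ
logU a b N = logS a b N Q.+ logE a b N

-- For c ≥ 0 and a, b ≥ 1:   "r ≤ c · log(a/b)"
-- i.e. the negation of  c · log(a/b) < r,  and  c·log(a/b) < r  holds iff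
-- some upper approximation satisfies c · U_N < r.
LeMulLog : ℚᵘ → ℚᵘ → ℕ → ℕ → Set
LeMulLog r c a b = ¬ (Σ ℕ λ N → c Q.* logU a b N Q.< r)

Edge : ℕ → Set
Edge n = Fin n × Fin n

_≟ₑ_ : ∀ {n} → DecidableEquality (Edge n)
_≟ₑ_ = ≡-dec _≟ᶠ_ _≟ᶠ_

edgesK : (n : ℕ) → List (Edge n)
edgesK n = filter (λ e → toℕ (Data.Product.proj₁ e) <? toℕ (Data.Product.proj₂ e))
                  (concatMap (λ i → map (λ j → (i , j)) (allFin n)) (allFin n))

Colorable : ∀ {n} → ℕ → List (Edge n) → Set
Colorable {n} k G = Σ (Fin n → Fin k) λ c → All (λ e → c (Data.Product.proj₁ e) ≢ c (Data.Product.proj₂ e)) G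

-- The (1:q) Client-Waiter game.
-- State: list of free (unoffered) edges, list of Client's edges
-- (Waiter's edges are irrelevant to the outcome).
-- A legal offer is a duplicate-free list S of free edges with
-- 1 ≤ |S| ≤ q + 1.

record Offer {n} (q : ℕ) (free : List (Edge n)) : Set where
  constructor offer
  field
    edges   : List (Edge n)
    unique  : Unique edges
    inFree  : All (_∈ free) edges
    nonEmpty : 1 ≤ length edges
    bounded : length edges ≤ suc q
open Offer public

removeOffered : ∀ {n} → List (Edge n) → List (Edge n) → List (Edge n)
removeOffered S free = filter (λ e → ¬? (mem? _≟ₑ_ e S)) free

data WaiterWins {n} (q : ℕ) (P : List (Edge n) → Set) : List (Edge n) → List (Edge n) → Set where
  done : ∀ {client} → P client → WaiterWins q P [] client
  move : ∀ {e₀ rest client} (S : Offer q (e₀ ∷ rest)) →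
         (∀ {e} → e ∈ edges S → WaiterWins q P (removeOffered (edges S) (e₀ ∷ rest)) (e ∷ client)) →
         WaiterWins q P (e₀ ∷ rest) client

data ClientWins {n} (q : ℕ) (P : List (Edge n) → Set) : List (Edge n) → List (Edge n) → Set where
  done : ∀ {client} → P client → ClientWins q P [] client
  move : ∀ {e₀ rest client} →
         ((S : Offer q (e₀ ∷ rest)) → Σ (Edge n) λ e → e ∈ edges S × ClientWins q P (removeOffered (edges S) (e₀ ∷ rest)) (e ∷ client)) →
         ClientWins q P (e₀ ∷ rest) client

WaiterCanEnsure : (n q : ℕ) → (List (Edge n) → Set) → Set
WaiterCanEnsure n q P = WaiterWins q P (edgesK n) []

ClientCanEnsure : (n q : ℕ) → (List (Edge n) → Set) → Set
ClientCanEnsure n q P = ClientWins q P (edgesK n) []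

ℕ→Q : ℕ → ℚᵘ
ℕ→Q m = mkℚᵘ (+ m) 0

-- Waiter.  Colour the vertices in order.  At vertex v, the edges to earlier vertices form k boxes, one per
-- colour, of total size below n, so some ⌊k/2⌋ boxes have size at most 2n/k.  Waiter repeatedly offers
-- ⌊(q+1)/j⌋ edges from each of the j boxes Client has not touched yet; each answer touches only one of them.
-- A box exhausted untouched yields a colour for v, and this happens if Σ_{2≤i≤⌊k/2⌋} ⌊(q+1)/i⌋ ≥ 2n/k, which
-- holds for q ≥ 4n/(k log k) and large k since the harmonic sum is about log k.  All other edges are then
-- harmless and are offered at the end.
--
-- Client.  A colouring with f monochromatic free edges has weight (q/(q+1))^f until Client owns one of
-- them.  By averaging, Client can always answer without increasing the total weight.  As 2kf ≥ n² − kn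
-- for every colouring and (1 + 1/q)^q ≥ 2, the total weight is at most k^n 2^(−(n²−kn)/(2kq)) < 1 at the
-- start, so at the end no colouring is proper.
module Submission where

open import Defs
open import Data.Nat
open import Data.Nat.Properties
open import Data.Nat.DivMod using (m/n*n≤m; m≡m%n+[m/n]*n; m%n<n; m/n≤m; /-mono-≤; m*n/n≡m)
open import Data.Nat.ListAction using (sum; product)
open import Data.Nat.ListAction.Properties using (product-++; product-↭)
open import Data.Nat.Tactic.RingSolver using (solve-∀)
open import Data.Integer as ℤ using (+≤+; +<+)
import Data.Integer.Properties as ℤ
open import Data.Rational.Unnormalised as Q using (mkℚᵘ; 1ℚᵘ; *≤*; *<*)
open import Data.Rational.Unnormalised using (ℚᵘ; 0ℚᵘ) renaming (_<_ to _<ℚ_; _+_ to _+ℚ_; _*_ to _*ℚ_)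
import Data.Rational.Unnormalised.Properties as Q
open import Data.Rational.Unnormalised.Solver using (module +-*-Solver)
open import Data.Fin as Fin using (Fin; toℕ; fromℕ<)
import Data.Fin.Properties as Fin
open import Data.Vec as Vec using (Vec)
import Data.Vec.Properties as Vec
open import Data.List
  using (List; []; _∷_; length; filter; allFin; concatMap; map; take; drop; _++_; tabulate; cartesianProduct; cartesianProductWith)
open import Data.List.Properties
  using (length-++; length-take; length-drop; length-filter; length-map; length-tabulate; filter-++; filter-accept;
         filter-none; filter-notAll; take++drop≡id; map-++)
open import Data.List.Relation.Unary.All as All using (All; []; _∷_)
import Data.List.Relation.Unary.All.Properties as All
open import Data.List.Relation.Unary.Any as Any using (Any; here; there)
open import Data.List.Relation.Unary.AllPairs using ([]; _∷_)
open import Data.List.Relation.Unary.Unique.Propositional using (Unique)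
import Data.List.Relation.Unary.Unique.Propositional.Properties as Unique
open import Data.List.Membership.Propositional using (_∈_; find; lose)
open import Data.List.Membership.Propositional.Properties
  using (∈-filter⁺; ∈-filter⁻; ∈-++⁺ˡ; ∈-++⁺ʳ; ∈-++⁻; ∈-length; ∈-concatMap⁺; ∈-concatMap⁻; ∈-allFin; ∈-cartesianProductWith⁺)
open import Data.List.Membership.Propositional.Properties.WithK using (unique∧set⇒bag)
open import Data.List.Membership.DecPropositional using () renaming (_∈?_ to mem?)
open import Data.List.Relation.Binary.BagAndSetEquality using (∼bag⇒↭)
open import Data.List.Relation.Binary.Permutation.Propositional using (_↭_)
import Data.List.Relation.Binary.Permutation.Propositional.Properties as Perm
open import Data.List.Relation.Binary.Sublist.Propositional as Sub using (_⊆_; ⊆-refl; ⊆-trans)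
open import Data.List.Relation.Binary.Sublist.Propositional.Properties using (All-resp-⊆; filter-⊆)
open import Data.Product using (Σ; ∃; _×_; _,_; proj₁; proj₂)
open import Data.Product.Properties using (≡-dec)
open import Data.Sum using (_⊎_; inj₁; inj₂)
open import Function using (_∘_; mk⇔)
open import Relation.Nullary using (¬_; Dec; yes; no; ¬?; contradiction)
open import Relation.Nullary.Decidable using (_×-dec_)
open import Relation.Unary using (Decidable)
open import Relation.Binary.Definitions using (tri<; tri≈; tri>)
open import Relation.Binary.PropositionalEquality hiding (J)
open import Algebra.Properties.CommutativeMonoid.Sum +-0-commutativeMonoid
  using (∑-comm; ∑-distrib-+) renaming (sum to ∑; sum-cong-≋ to ∑-cong)
open import Algebra.Properties.Semiring.Sum +-*-semiring using (*-distribˡ-sum; *-distribʳ-sum)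

-- The box game

-- The logarithm enters only through its upper approximations: a hypothesis r ≤ c log x says that r
-- ≤ c U_N for every N, so a proof may pick one convenient N and needs only an upper bound on that
-- U_N. On Waiter's side U_N for log k has to be compared with harmonic sums. The constant 4 leaves
-- a factor of two: the threshold is about q log k, while 2n/k is required. Hence, with J = ⌊k/2⌋,
-- it suffices that U_N ≤ 2 H_J - 4 for some N, which holds for k ≥ `K₀`; the 4 pays for all
-- roundings. Below `K₀` the value α = k² + 1 forces q ≥ 2n, where two boxes are enough, and
-- finitely many values do not affect α → 0. On Client's side the term kn in n² - kn costs a factor
-- 2^k, so the goal is 2^k k^(2qk) < 2^n. The hypothesis gives log(2^n / k^(2qk)) ≥ 2αn, and α ≥
-- 1/(k + 1) makes the right side exceed 2^k for large n. Such a margin allows crude bounds like U_0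
-- ≤ a/(2b) for a ≥ b.

module _ {A : Set} where

  length-filter-partition : {P : A → Set} (P? : Decidable P) → ∀ xs →
    length (filter P? xs) + length (filter (¬? ∘ P?) xs) ≡ length xs
  length-filter-partition P? [] = refl
  length-filter-partition P? (x ∷ xs) with P? x
  ... | yes _ = cong suc (length-filter-partition P? xs)
  ... | no  _ = trans (+-suc _ _) (cong suc (length-filter-partition P? xs))

  filter-filter-⊆ : {P Q : A → Set} (P? : Decidable P) (Q? : Decidable Q) → ∀ xs →
    (∀ {x} → P x → Q x) → filter P? (filter Q? xs) ≡ filter P? xs
  filter-filter-⊆ P? Q? [] P⊆Q = refl
  filter-filter-⊆ P? Q? (x ∷ xs) P⊆Q with Q? x
  filter-filter-⊆ P? Q? (x ∷ xs) P⊆Q | yes q with P? x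
  ... | yes _ = cong (x ∷_) (filter-filter-⊆ P? Q? xs P⊆Q)
  ... | no  _ = filter-filter-⊆ P? Q? xs P⊆Q
  filter-filter-⊆ P? Q? (x ∷ xs) P⊆Q | no ¬q with P? x
  ... | yes p = contradiction (P⊆Q p) ¬q
  ... | no  _ = filter-filter-⊆ P? Q? xs P⊆Q

  filter-swap : {P Q : A → Set} (P? : Decidable P) (Q? : Decidable Q) → ∀ xs →
    filter P? (filter Q? xs) ≡ filter Q? (filter P? xs)
  filter-swap P? Q? [] = refl
  filter-swap P? Q? (x ∷ xs) with P? x in p | Q? x in q
  ... | yes _ | yes _ rewrite p | q = cong (x ∷_) (filter-swap P? Q? xs)
  ... | yes _ | no  _ rewrite q = filter-swap P? Q? xs
  ... | no  _ | yes _ rewrite p = filter-swap P? Q? xs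
  ... | no  _ | no  _ = filter-swap P? Q? xs

  length-filter-none-take : {P : A → Set} (P? : Decidable P) → ∀ d xs →
    All (λ x → ¬ P x) (take d xs) → length (filter P? xs) ≤ length xs ∸ d
  length-filter-none-take P? d xs none = begin
    length (filter P? xs)                                      ≡⟨ cong (length ∘ filter P?) (take++drop≡id d xs) ⟨
    length (filter P? (take d xs ++ drop d xs))                ≡⟨ cong length (filter-++ P? (take d xs) _) ⟩
    length (filter P? (take d xs) ++ filter P? (drop d xs))    ≡⟨ cong (λ ys → length (ys ++ filter P? (drop d xs))) (filter-none P? none) ⟩
    length (filter P? (drop d xs))                             ≤⟨ length-filter P? (drop d xs) ⟩
    length (drop d xs)                                         ≡⟨ length-drop d xs ⟩
    length xs ∸ d                                              ∎
    where open ≤-Reasoning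

  take-∈ : ∀ d {xs} {x : A} → x ∈ take d xs → x ∈ xs
  take-∈ d {xs} x∈ = subst (_ ∈_) (take++drop≡id d xs) (∈-++⁺ˡ x∈)

  delete : ∀ {xs} {x : A} → Unique xs → x ∈ xs →
    ∃ λ ys → length xs ≡ suc (length ys) × Unique ys × (∀ {y} → y ∈ ys → y ∈ xs × y ≢ x)
  delete (x∉ ∷ u) (here refl) = _ , refl , u , λ y∈ → there y∈ , λ { refl → All.lookup x∉ y∈ refl }
  delete (x∉ ∷ u) (there x∈) with delete u x∈
  ... | ys , len , u′ , sub = _ ∷ ys , cong suc len , All.tabulate (λ y∈ → All.lookup x∉ (proj₁ (sub y∈))) ∷ u′ ,
    λ { (here refl) → here refl , All.lookup x∉ x∈ ; (there y∈) → there (proj₁ (sub y∈)) , proj₂ (sub y∈) }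

-- Pigeonhole by peeling: deleting the members of the first class from `xs` leaves, by disjointness,
-- the counts of the other classes intact.
packing : {A B : Set} {P : A → B → Set} (P? : ∀ a → Decidable (P a)) →
  (∀ {a b x} → P a x → P b x → a ≡ b) → ∀ m {L} → Unique L → ∀ xs →
  All (λ a → m ≤ length (filter (P? a) xs)) L → m * length L ≤ length xs
packing P? disjoint m [] xs [] = ≤-trans (≤-reflexive (*-zeroʳ m)) z≤n
packing P? disjoint m {a ∷ L} (a∉L ∷ u) xs (m≤a ∷ m≤L) = begin
  m * suc (length L)                                              ≡⟨ *-suc m (length L) ⟩
  m + m * length L                                                ≤⟨ +-mono-≤ m≤a (packing P? disjoint m u (filter (¬? ∘ P? a) xs) (All.zipWith large (a∉L , m≤L))) ⟩
  length (filter (P? a) xs) + length (filter (¬? ∘ P? a) xs)      ≡⟨ length-filter-partition (P? a) xs ⟩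
  length xs                                                       ∎
  where
  open ≤-Reasoning
  large : ∀ {b} → (a ≢ b × m ≤ length (filter (P? b) xs)) → m ≤ length (filter (P? b) (filter (¬? ∘ P? a) xs))
  large (a≢b , m≤b) = subst (λ ys → m ≤ length ys)
    (sym (filter-filter-⊆ (P? _) (¬? ∘ P? a) xs λ pb pa → a≢b (disjoint pa pb))) m≤b

module _ {n : ℕ} {q : ℕ} {P : List (Edge n) → Set} where

  -- `move` asks for a visibly nonempty list of free edges; a legal offer already forces one.
  offerMove : ∀ {free client} (S : Offer q free) →
    (∀ {e} → e ∈ edges S → WaiterWins q P (removeOffered (edges S) free) (e ∷ client)) →
    WaiterWins q P free client
  offerMove {[]} (offer [] _ _ () _) _
  offerMove {[]} (offer (_ ∷ _) _ (() ∷ _) _ _) _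
  offerMove {_ ∷ _} S k = move S k

removeOffered-⊆ : ∀ {n} S (free : List (Edge n)) → removeOffered S free ⊆ free
removeOffered-⊆ S free = filter-⊆ (λ e → ¬? (mem? _≟ₑ_ e S)) free

-- Single-edge offers leave Client no choice, so an edgewise property `R` of all free edges passes
-- to Client's final graph. The number `m` is fuel for the recursion.
waiterOffersRest : ∀ {n q} {R : Edge n → Set} {P : List (Edge n) → Set} → (∀ {client} → All R client → P client) →
  ∀ m {free client} → length free ≤ m → All R free → All R client → WaiterWins q P free client
waiterOffersRest done! m {[]} _ _ r = done (done! r)
waiterOffersRest done! (suc m) {e ∷ free} (s≤s len) (re ∷ rf) rc =
  move (offer (e ∷ []) ([] ∷ []) (here refl ∷ []) (s≤s z≤n) (s≤s z≤n))
    λ { (here refl) → waiterOffersRest done! m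
          (≤-trans (≤-pred (filter-notAll (λ e′ → ¬? (mem? _≟ₑ_ e′ (e ∷ []))) (e ∷ free) (here λ e∉ → e∉ (here refl)))) len)
          (All-resp-⊆ (removeOffered-⊆ (e ∷ []) (e ∷ free)) (re ∷ rf)) (re ∷ rc) }

-- The index j stands for j + 1 untouched boxes. A single remaining box must already be empty, hence
-- the value 0 at j = 0.
boxThreshold : ℕ → ℕ → ℕ
boxThreshold q zero    = 0
boxThreshold q (suc j) = suc q / suc (suc j) + boxThreshold q j

module Boxes {n k : ℕ} {InBox : Fin k → Edge n → Set} (inBox? : ∀ a → Decidable (InBox a))
  (disjoint : ∀ {a b e} → InBox a e → InBox b e → a ≡ b) where

  box : List (Edge n) → Fin k → List (Edge n)
  box free a = filter (inBox? a) free

  pieces : ℕ → List (Edge n) → List (Fin k) → List (Edge n)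
  pieces d free = concatMap (take d ∘ box free)

  ∈-pieces⁻ : ∀ d free A {e} → e ∈ pieces d free A → ∃ λ a → a ∈ A × e ∈ take d (box free a)
  ∈-pieces⁻ d free A e∈ = find (∈-concatMap⁻ (take d ∘ box free) {xs = A} e∈)

  ∈-pieces⁺ : ∀ d free {A a e} → a ∈ A → e ∈ take d (box free a) → e ∈ pieces d free A
  ∈-pieces⁺ d free a∈ e∈ = ∈-concatMap⁺ (take d ∘ box free) (lose a∈ e∈)

  ∈-piece⇒InBox : ∀ d free {a e} → e ∈ take d (box free a) → e ∈ free × InBox a e
  ∈-piece⇒InBox d free {a} e∈ = ∈-filter⁻ (inBox? a) {xs = free} (take-∈ d e∈)

  length-pieces : ∀ d free A → length (pieces d free A) ≤ length A * d
  length-pieces d free [] = z≤n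
  length-pieces d free (a ∷ A) = begin
    length (take d (box free a) ++ pieces d free A)           ≡⟨ length-++ (take d (box free a)) ⟩
    length (take d (box free a)) + length (pieces d free A)   ≤⟨ +-mono-≤ (≤-trans (≤-reflexive (length-take d (box free a))) (m⊓n≤m d _)) (length-pieces d free A) ⟩
    d + length A * d                                          ∎
    where open ≤-Reasoning

  pieces-unique : ∀ d {free A} → Unique free → Unique A → Unique (pieces d free A)
  pieces-unique d uf [] = []
  pieces-unique d {free} {a ∷ A} uf (a∉ ∷ uA) =
    Unique.++⁺ (Unique.take⁺ d (Unique.filter⁺ (inBox? a) uf)) (pieces-unique d uf uA) λ { (e∈a , e∈A) → apart e∈a (∈-pieces⁻ d free A e∈A) }
    where
    apart : ∀ {e} → e ∈ take d (box free a) → ¬ ∃ λ b → b ∈ A × e ∈ take d (box free b)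
    apart e∈a (b , b∈ , e∈b) = All.lookup a∉ b∈ (disjoint (proj₂ (∈-piece⇒InBox d free e∈a)) (proj₂ (∈-piece⇒InBox d free e∈b)))

  length-box-removeOffered : ∀ d free {A a} → a ∈ A →
    length (box (removeOffered (pieces d free A) free) a) ≤ length (box free a) ∸ d
  length-box-removeOffered d free {A} {a} a∈ =
    subst (λ es → length es ≤ length (box free a) ∸ d)
      (filter-swap (λ e → ¬? (mem? _≟ₑ_ e (pieces d free A))) (inBox? a) free)
      (length-filter-none-take (λ e → ¬? (mem? _≟ₑ_ e (pieces d free A))) d (box free a)
        (All.tabulate λ e∈ e∉ → e∉ (∈-pieces⁺ d free a∈ e∈)))

  module _ {q : ℕ} {P : List (Edge n) → Set} {Q : Edge n → Set} {free₀ : List (Edge n)}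
    (picked : ∀ {a e} → e ∈ free₀ → InBox a e → Q e)
    (finish : ∀ {free client} → free ⊆ free₀ → Unique free → All Q client → ∀ a →
      All (¬_ ∘ InBox a) free → All (¬_ ∘ InBox a) client → WaiterWins q P free client) where

    -- Invariant: `A` holds j + 1 boxes untouched by Client, each within the threshold. An answer
    -- lies in one box only, so the j others stay untouched and each loses its share ⌊(q+1)/(j+1)⌋
    -- of the offer. `Q` records what is known of every edge Client picks, and `finish` takes over
    -- once some box has run out untouched.
    boxGame : ∀ j A → length A ≡ suc j → Unique A → ∀ {free client} → free ⊆ free₀ → Unique free → All Q client →
      (∀ {a} → a ∈ A → length (box free a) ≤ boxThreshold q j) →
      (∀ {a} → a ∈ A → All (¬_ ∘ InBox a) client) →
      WaiterWins q P free client

    boxGame-full : ∀ j A → length A ≡ suc j → Unique A → ∀ {free client} → free ⊆ free₀ → Unique free → All Q client →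
      (∀ {a} → a ∈ A → length (box free a) ≤ boxThreshold q j) →
      (∀ {a} → a ∈ A → All (¬_ ∘ InBox a) client) →
      (∀ {a} → a ∈ A → box free a ≢ []) →
      WaiterWins q P free client

    boxGame j A len uA {free} free⊆ uf qc small avoids with Any.any? (λ a → length (box free a) ≟ 0) A
    ... | no  ¬empty = boxGame-full j A len uA free⊆ uf qc small avoids λ a∈ eq → ¬empty (lose a∈ (cong length eq))
    ... | yes empty with find empty
    ... | a , a∈ , eq = finish free⊆ uf qc a
      (All.tabulate λ e∈ inBox → <⇒≢ (∈-length (∈-filter⁺ (inBox? a) e∈ inBox)) (sym eq)) (avoids a∈)

    -- With one box left the threshold is 0, so this box is empty, against `full`.
    boxGame-full zero (a ∷ A) len uA {free} free⊆ uf qc small avoids full with box free a | full (here refl) | small (here refl)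
    ... | [] | ne | _ = contradiction refl ne
    boxGame-full (suc j) A len uA {free} {client} free⊆ uf qc small avoids full with suc q / suc (suc j) in eq
    -- The share is 0, so no legal offer would come from it; the threshold does not change either,
    -- and a box is dropped from `A` without a move.
    boxGame-full (suc j) (a ∷ A) len (_ ∷ uA) free⊆ uf qc small avoids full | zero =
      boxGame j A (suc-injective len) uA free⊆ uf qc (small ∘ there) (avoids ∘ there)
    boxGame-full (suc j) (a₀ ∷ A₀) len uA {free} {client} free⊆ uf qc small avoids full | d@(suc d-1) =
      offerMove
        (offer (pieces d free A) (pieces-unique d uf uA)
          (All.tabulate λ e∈ → proj₁ (∈-piece⇒InBox d free (proj₂ (proj₂ (∈-pieces⁻ d free A e∈)))))
          nonempty short)
        reply
      where
      A = a₀ ∷ A₀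
      nonempty : 1 ≤ length (pieces d free A)
      nonempty with box free a₀ | full (here refl)
      ... | []    | ne = contradiction refl ne
      ... | _ ∷ _ | _  = s≤s z≤n
      short : length (pieces d free A) ≤ suc q
      short = begin
        length (pieces d free A)                        ≤⟨ length-pieces d free A ⟩
        length A * d                                    ≡⟨ cong (_* d) len ⟩
        suc (suc j) * d                                 ≡⟨ *-comm (suc (suc j)) d ⟩
        d * suc (suc j)                                 ≡⟨ cong (_* suc (suc j)) eq ⟨
        suc q / suc (suc j) * suc (suc j)               ≤⟨ m/n*n≤m (suc q) (suc (suc j)) ⟩
        suc q                                           ∎
        where open ≤-Reasoning
      reply : ∀ {e} → e ∈ pieces d free A → WaiterWins q P (removeOffered (pieces d free A) free) (e ∷ client)
      reply {e} e∈ with ∈-pieces⁻ d free A e∈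
      ... | a , a∈ , e∈a with delete uA a∈ | ∈-piece⇒InBox d free e∈a
      ... | B , lenB , uB , B⊆ | e∈free , inBox =
        boxGame j B (suc-injective (trans (sym lenB) len)) uB
          (⊆-trans (removeOffered-⊆ (pieces d free A) free) free⊆) (Unique.filter⁺ (λ e′ → ¬? (mem? _≟ₑ_ e′ (pieces d free A))) uf)
          (picked (Sub.lookup free⊆ e∈free) inBox ∷ qc)
          (λ b∈ → ≤-trans (length-box-removeOffered d free (proj₁ (B⊆ b∈)))
            (≤-trans (∸-monoˡ-≤ d (small (proj₁ (B⊆ b∈)))) (≤-reflexive (m+n∸m≡n d _))))
          (λ b∈ → (λ inB → proj₂ (B⊆ b∈) (disjoint inB inBox)) ∷ avoids (proj₁ (B⊆ b∈)))

-- Waiter colours the vertices in order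

recolor : ∀ {n k} → (Fin n → Fin k) → Fin n → Fin k → Fin n → Fin k
recolor c v a x with x Fin.≟ v
... | yes _ = a
... | no  _ = c x

recolor-there : ∀ {n k} (c : Fin n → Fin k) {v} a {x} → x ≢ v → recolor c v a x ≡ c x
recolor-there c {v} a {x} x≢v with x Fin.≟ v
... | yes x≡v = contradiction x≡v x≢v
... | no  _   = refl

allPairs : ∀ n → List (Edge n)
allPairs n = concatMap (λ i → map (λ j → i , j) (allFin n)) (allFin n)

forward? : ∀ {n} → Decidable (λ (e : Edge n) → toℕ (proj₁ e) < toℕ (proj₂ e))
forward? e = toℕ (proj₁ e) <? toℕ (proj₂ e)

allPairs-unique : ∀ n → Unique (allPairs n)
allPairs-unique n = subst Unique (sym (concatMap≡ (allFin n))) (Unique.cartesianProduct⁺ (Unique.allFin⁺ n) (Unique.allFin⁺ n))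
  where
  concatMap≡ : ∀ is → concatMap (λ i → map (λ j → i , j) (allFin n)) is ≡ cartesianProduct is (allFin n)
  concatMap≡ []       = refl
  concatMap≡ (i ∷ is) = cong (map (λ j → i , j) (allFin n) ++_) (concatMap≡ is)

edgesK-unique : ∀ n → Unique (edgesK n)
edgesK-unique n = Unique.filter⁺ forward? (allPairs-unique n)

-- `packing` with unusual roles: every edge into `v` is a class on `allFin n`, whose only member is
-- the tail of the edge.
length-edgesInto : ∀ {n} {free : List (Edge n)} → Unique free → ∀ v →
  length (filter (λ e → proj₂ e Fin.≟ v) free) ≤ n
length-edgesInto {n} {free} uf v = begin
  length into             ≡⟨ *-identityˡ (length into) ⟨
  1 * length into         ≤⟨ packing (λ e i → ≡-dec Fin._≟_ Fin._≟_ e (i , v)) (λ p p′ → trans p (sym p′)) 1 (Unique.filter⁺ (λ e → proj₂ e Fin.≟ v) uf) (allFin n) (All.tabulate occurs) ⟩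
  length (allFin n)       ≡⟨ length-tabulate {n = n} (λ i → i) ⟩
  n                       ∎
  where
  open ≤-Reasoning
  into = filter (λ e → proj₂ e Fin.≟ v) free
  occurs : ∀ {e} → e ∈ into → 1 ≤ length (filter (λ i → ≡-dec Fin._≟_ Fin._≟_ e (i , v)) (allFin n))
  occurs {i , j} e∈ = ∈-length (∈-filter⁺ (λ i′ → ≡-dec Fin._≟_ Fin._≟_ (i , j) (i′ , v)) (∈-allFin i)
    (cong (i ,_) (proj₂ (∈-filter⁻ (λ e → proj₂ e Fin.≟ v) {xs = free} e∈))))

-- At each vertex j + 1 boxes of size at most r are played. They exist because otherwise k - j boxes
-- would have at least r + 1 edges each, more than the n available by the second hypothesis.
module _ {n k q j r : ℕ} (j<k : suc j ≤ k) (n<boxes : n < suc r * suc (k ∸ suc j)) (r≤ : r ≤ boxThreshold q j) where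

  -- Required of free edges as well as of Client's: an edge left over at a coloured vertex is then
  -- safe whenever Client takes it, so leftovers can wait until the end.
  Sound : ℕ → (Fin n → Fin k) → Edge n → Set
  Sound t c e = toℕ (proj₁ e) < toℕ (proj₂ e) × (toℕ (proj₂ e) < t → c (proj₁ e) ≢ c (proj₂ e))

  module _ (v : Fin n) (c : Fin n → Fin k) where

    InBox : Fin k → Edge n → Set
    InBox a e = proj₂ e ≡ v × c (proj₁ e) ≡ a

    inBox? : ∀ a → Decidable (InBox a)
    inBox? a e = proj₂ e Fin.≟ v ×-dec c (proj₁ e) Fin.≟ a

    smallBoxes : ∀ {free} → Unique free → ∃ λ A → length A ≡ suc j × Unique A ×
      (∀ {a} → a ∈ A → length (filter (inBox? a) free) ≤ r)
    smallBoxes {free} uf = take (suc j) good ,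
      trans (length-take (suc j) good) (m≤n⇒m⊓n≡m enough) ,
      Unique.take⁺ (suc j) (Unique.filter⁺ small? (Unique.allFin⁺ k)) ,
      λ a∈ → proj₂ (∈-filter⁻ small? {xs = allFin k} (take-∈ (suc j) a∈))
      where
      small? : Decidable (λ a → length (filter (inBox? a) free) ≤ r)
      small? a = length (filter (inBox? a) free) ≤? r
      good bad : List (Fin k)
      good = filter small? (allFin k)
      bad  = filter (¬? ∘ small?) (allFin k)
      into = filter (λ e → proj₂ e Fin.≟ v) free
      bad-large : suc r * length bad ≤ n
      bad-large = ≤-trans
        (packing inBox? (λ p p′ → trans (sym (proj₂ p)) (proj₂ p′)) (suc r) (Unique.filter⁺ (¬? ∘ small?) (Unique.allFin⁺ k)) into
          (All.tabulate λ {a} a∈ → subst (λ es → suc r ≤ length es)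
            (sym (filter-filter-⊆ (inBox? a) (λ e → proj₂ e Fin.≟ v) free proj₁))
            (≰⇒> (proj₂ (∈-filter⁻ (¬? ∘ small?) {xs = allFin k} a∈)))))
        (length-edgesInto uf v)
      enough : suc j ≤ length good
      enough with suc j ≤? length good
      ... | yes p = p
      ... | no ¬p = contradiction (≤-trans n<boxes (≤-trans (*-monoʳ-≤ (suc r) many) bad-large)) (<-irrefl refl)
        where
        many : suc (k ∸ suc j) ≤ length bad
        many = +-cancelˡ-≤ j _ _ (begin
          j + suc (k ∸ suc j)             ≡⟨ +-suc j _ ⟩
          suc j + (k ∸ suc j)             ≡⟨ m+[n∸m]≡n j<k ⟩
          k                               ≡⟨ length-tabulate {n = k} (λ i → i) ⟨
          length (allFin k)               ≡⟨ length-filter-partition small? (allFin k) ⟨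
          length good + length bad        ≤⟨ +-monoˡ-≤ (length bad) (≤-pred (≰⇒> ¬p)) ⟩
          j + length bad                  ∎)
          where open ≤-Reasoning

    -- Only edges with later endpoint `v` acquire a new constraint, and they would break it only by
    -- lying in box `a`. Edges leaving `v` end beyond `v`, where nothing is required yet.
    extend : ∀ {a e} → Sound (toℕ v) c e → ¬ InBox a e → Sound (suc (toℕ v)) (recolor c v a) e
    extend {a} {x , y} (x<y , proper) ¬inBox = x<y , proper′
      where
      proper′ : toℕ y < suc (toℕ v) → recolor c v a x ≢ recolor c v a y
      proper′ (s≤s y≤v) eq with y Fin.≟ v
      ... | yes refl = ¬inBox (refl , trans (sym (recolor-there c a (λ { refl → <-irrefl refl x<y }))) eq)
      ... | no  y≢v  = proper y<v (trans (sym (recolor-there c a λ { refl → <-asym x<y y<v })) eq)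
        where
        y<v : toℕ y < toℕ v
        y<v = ≤∧≢⇒< y≤v (y≢v ∘ Fin.toℕ-injective)

  -- Client's edges all end below `t`, since Waiter has offered only edges into coloured vertices.
  -- So the boxes of the next vertex start untouched.
  colorFrom : ∀ m t → t + m ≡ n → (c : Fin n → Fin k) → ∀ {free client} → Unique free →
    All (Sound t c) free → All (λ e → Sound t c e × toℕ (proj₂ e) < t) client →
    WaiterWins q (Colorable k) free client
  colorFrom zero t t≡n c {free} uf sf sc =
    waiterOffersRest {R = λ e → c (proj₁ e) ≢ c (proj₂ e)} (c ,_) (length free) ≤-refl
      (All.map (λ {e} s → proj₂ s (≤-trans (Fin.toℕ<n (proj₂ e)) (≤-reflexive (trans (sym t≡n) (+-identityʳ t))))) sf)
      (All.map (λ s → proj₂ (proj₁ s) (proj₂ s)) sc)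
  colorFrom (suc m) t t+m≡n c {free} uf sf sc with fromℕ< t<n | Fin.toℕ-fromℕ< t<n
    where
    t<n : t < n
    t<n = subst (t <_) t+m≡n (m<m+n t (s≤s z≤n))
  ... | v | refl with smallBoxes v c uf
  ... | A , lenA , uA , small =
    Boxes.boxGame (inBox? v c) (λ p p′ → trans (sym (proj₂ p)) (proj₂ p′))
      {Q = λ e → Sound (toℕ v) c e × toℕ (proj₂ e) < suc (toℕ v)} {free₀ = free}
      (λ { e∈ (refl , _) → All.lookup sf e∈ , ≤-refl })
      (λ {free′} free⊆ uf′ sc′ a ¬f ¬c → colorFrom m (suc (toℕ v)) (trans (sym (+-suc (toℕ v) m)) t+m≡n) (recolor c v a) uf′
        (All.zipWith (λ (s , ¬b) → extend v c s ¬b) (All-resp-⊆ free⊆ sf , ¬f))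
        (All.zipWith (λ ((s , lt) , ¬b) → extend v c s ¬b , lt) (sc′ , ¬c)))
      j A lenA uA ⊆-refl uf
      (All.map (λ (s , lt) → s , m≤n⇒m≤1+n lt) sc)
      (λ a∈ → ≤-trans (small a∈) r≤)
      (λ _ → All.map (λ { (_ , lt) (refl , _) → <-irrefl refl lt }) sc)

  waiterColors : WaiterCanEnsure n q (Colorable k)
  -- The initial colouring is an arbitrary default: at t = 0 it constrains no edge.
  waiterColors = colorFrom n 0 refl (λ _ → fromℕ< {0} (≤-trans (s≤s z≤n) j<k)) (edgesK-unique n)
    (All.map (λ x<y → x<y , λ ()) (All.all-filter forward? (allPairs n))) []

-- Client hits every colouring

-- Duplicate-free lists with the same members are permutations of each other. This splits the
-- product weight of the free edges into an offered and a remaining factor.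
removeOffered-↭ : ∀ {n} {S free : List (Edge n)} → Unique S → Unique free → All (_∈ free) S →
  free ↭ S ++ removeOffered S free
removeOffered-↭ {S = S} {free} uS uf S⊆ = ∼bag⇒↭ (unique∧set⇒bag uf
  (Unique.++⁺ uS (Unique.filter⁺ outside? uf) λ (e∈S , e∈rest) → proj₂ (∈-filter⁻ outside? {xs = free} e∈rest) e∈S)
  (mk⇔ to from))
  where
  outside? : Decidable (λ e → ¬ (e ∈ S))
  outside? e = ¬? (mem? _≟ₑ_ e S)
  to : ∀ {e} → e ∈ free → e ∈ S ++ removeOffered S free
  to {e} e∈ with mem? _≟ₑ_ e S
  ... | yes e∈S = ∈-++⁺ˡ e∈S
  ... | no  e∉S = ∈-++⁺ʳ S (∈-filter⁺ outside? e∈ e∉S)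
  from : ∀ {e} → e ∈ S ++ removeOffered S free → e ∈ free
  from e∈ with ∈-++⁻ S e∈
  ... | inj₁ e∈S    = All.lookup S⊆ e∈S
  ... | inj₂ e∈rest = proj₁ (∈-filter⁻ outside? e∈rest)

∃-below-average : {A : Set} (f : A → ℕ) → ∀ B xs → sum (map f xs) < length xs * B → ∃ λ x → x ∈ xs × f x < B
∃-below-average f B (x ∷ xs) lt with f x <? B
... | yes fx<B = x , here refl , fx<B
... | no  fx≮B with ∃-below-average f B xs (+-cancelˡ-< B _ _ (≤-<-trans (+-monoˡ-≤ _ (≮⇒≥ fx≮B)) lt))
... | y , y∈ , fy<B = y , there y∈ , fy<B

-- This is (1 + 1/q)^m ≥ 1 + m/q with denominators cleared.
bernoulli : ∀ q m → (q + m) * q ^ m ≤ q * suc q ^ m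
bernoulli q zero    = ≤-reflexive (cong (_* 1) (+-identityʳ q))
bernoulli q (suc m) = begin
  (q + suc m) * (q * q ^ m)              ≤⟨ m≤m+n _ (m * q ^ m) ⟩
  (q + suc m) * (q * q ^ m) + m * q ^ m  ≡⟨ expand q m (q ^ m) ⟩
  suc q * ((q + m) * q ^ m)              ≤⟨ *-monoʳ-≤ (suc q) (bernoulli q m) ⟩
  suc q * (q * suc q ^ m)                ≡⟨ swap (suc q) q (suc q ^ m) ⟩
  q * (suc q * suc q ^ m)                ∎
  where
  open ≤-Reasoning
  expand : ∀ q m x → (q + suc m) * (q * x) + m * x ≡ suc q * ((q + m) * x)
  expand = solve-∀
  swap : ∀ a b c → a * (b * c) ≡ b * (a * c)
  swap = solve-∀

-- 1 − t/s ≤ (1 − 1/(q+1))ᵗ for s = t + u ≤ q + 1, with denominators cleared.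
miss-probability : ∀ q t u → t + u ≤ suc q → u * suc q ^ t ≤ (t + u) * q ^ t
miss-probability q zero    u _ = ≤-refl
miss-probability q (suc t) u (s≤s t+u≤q) = begin
  u * (suc q * suc q ^ t)         ≡⟨ swap u (suc q) (suc q ^ t) ⟩
  suc q * (u * suc q ^ t)         ≤⟨ *-monoʳ-≤ (suc q) (miss-probability q t u (m≤n⇒m≤1+n t+u≤q)) ⟩
  suc q * ((t + u) * q ^ t)       ≡⟨ expand q (t + u) (q ^ t) ⟩
  ((t + u) * q + (t + u)) * q ^ t ≤⟨ *-monoˡ-≤ (q ^ t) (+-monoʳ-≤ ((t + u) * q) t+u≤q) ⟩
  ((t + u) * q + q) * q ^ t       ≡⟨ collect q (t + u) (q ^ t) ⟩
  suc (t + u) * (q * q ^ t)       ∎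
  where
  open ≤-Reasoning
  swap : ∀ a b c → a * (b * c) ≡ b * (a * c)
  swap = solve-∀
  expand : ∀ q s x → suc q * (s * x) ≡ (s * q + s) * x
  expand = solve-∀
  collect : ∀ q s x → (s * q + q) * x ≡ suc s * (q * x)
  collect = solve-∀

-- A target i that Client has not hit yet keeps the weight (q/(q+1))^h, where h is the number of
-- free edges hitting it; the common denominator (q+1)^|free| is cleared.
module Targets {n q : ℕ} {I : Set} {Hit : I → Edge n → Set} (hit? : ∀ i → Decidable (Hit i)) where

  factor : I → Edge n → ℕ
  factor i e with hit? i e
  ... | yes _ = q
  ... | no  _ = suc q

  weight : List (Edge n) → I → ℕ
  weight es i = product (map (factor i) es)

  weight-++ : ∀ es fs i → weight (es ++ fs) i ≡ weight es i * weight fs i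
  weight-++ es fs i = trans (cong product (map-++ (factor i) es fs)) (product-++ (map (factor i) es) _)

  weight-↭ : ∀ {es fs} i → es ↭ fs → weight es i ≡ weight fs i
  weight-↭ i p = product-↭ (Perm.map⁺ (factor i) p)

  hits misses : List (Edge n) → I → ℕ
  hits   es i = length (filter (hit? i) es)
  misses es i = length (filter (¬? ∘ hit? i) es)

  weight≡ : ∀ es i → weight es i ≡ q ^ hits es i * suc q ^ misses es i
  weight≡ [] i = refl
  weight≡ (e ∷ es) i with hit? i e
  ... | yes _ = trans (cong (q *_) (weight≡ es i)) (sym (*-assoc q _ _))
  ... | no  _ = trans (cong (suc q *_) (weight≡ es i)) (swap (suc q) (q ^ hits es i) _)
    where
    swap : ∀ a b c → a * (b * c) ≡ b * (a * c)
    swap = solve-∀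

  potential : List (Edge n) → List I → ℕ
  potential es Is = sum (map (weight es) Is)

  survivors : Edge n → List I → List I
  survivors e = filter (λ i → ¬? (hit? i e))

  -- A uniformly random answer from `S` misses i with probability at most (q/(q+1))^t, where t
  -- counts the hits of i in `S`. This is the factor that i's weight regains when `S` is removed.
  misses-weight : ∀ S i → length S ≤ suc q → misses S i * suc q ^ length S ≤ length S * weight S i
  misses-weight S i short = begin
    u * suc q ^ length S            ≡⟨ cong (λ s → u * suc q ^ s) parts ⟨
    u * suc q ^ (t + u)             ≡⟨ cong (u *_) (^-distribˡ-+-* (suc q) t u) ⟩
    u * (suc q ^ t * suc q ^ u)     ≡⟨ *-assoc u _ _ ⟨
    u * suc q ^ t * suc q ^ u       ≤⟨ *-monoˡ-≤ (suc q ^ u) (miss-probability q t u (≤-trans (≤-reflexive parts) short)) ⟩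
    (t + u) * q ^ t * suc q ^ u     ≡⟨ *-assoc (t + u) _ _ ⟩
    (t + u) * (q ^ t * suc q ^ u)   ≡⟨ cong₂ _*_ parts (sym (weight≡ S i)) ⟩
    length S * weight S i           ∎
    where
    open ≤-Reasoning
    t = hits S i
    u = misses S i
    parts = length-filter-partition (hit? i) S

  -- Double counting: the target i survives exactly the answers in `S` that miss it.
  sum-survivors : ∀ S rest i Is →
    sum (map (λ e → potential rest (survivors e (i ∷ Is))) S) ≡
    misses S i * weight rest i + sum (map (λ e → potential rest (survivors e Is)) S)
  sum-survivors [] rest i Is = refl
  sum-survivors (e ∷ S) rest i Is with hit? i e | sum-survivors S rest i Is
  ... | yes _ | ih = trans (cong (potential rest (survivors e Is) +_) ih) (swap (potential rest (survivors e Is)) (misses S i * weight rest i) _)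
    where
    swap : ∀ a b c → a + (b + c) ≡ b + (a + c)
    swap = solve-∀
  ... | no  _ | ih = trans (cong (weight rest i + potential rest (survivors e Is) +_) ih)
      (swap (weight rest i) (potential rest (survivors e Is)) (misses S i * weight rest i) _)
    where
    swap : ∀ a b c d → (a + b) + (c + d) ≡ (a + c) + (b + d)
    swap = solve-∀

  -- A uniformly random answer does not raise the expected total weight: by `misses-weight`, the
  -- chance of survival offsets the factor that each surviving target regains.
  average-potential : ∀ S {free rest} → free ↭ S ++ rest → length S ≤ suc q → ∀ Is →
    sum (map (λ e → potential rest (survivors e Is)) S) * suc q ^ length S ≤ length S * potential free Is
  average-potential S {free} {rest} p short [] =
    ≤-trans (≤-reflexive (cong (_* suc q ^ length S) (zeros S))) z≤n
    where
    zeros : ∀ S → sum (map (λ e → potential rest (survivors e [])) S) ≡ 0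
    zeros []      = refl
    zeros (_ ∷ S) = zeros S
  average-potential S {free} {rest} p short (i ∷ Is) = begin
    sum (map (λ e → potential rest (survivors e (i ∷ Is))) S) * Q   ≡⟨ cong (_* Q) (sum-survivors S rest i Is) ⟩
    (misses S i * weight rest i + total) * Q                       ≡⟨ expand (misses S i) (weight rest i) total Q ⟩
    misses S i * Q * weight rest i + total * Q                     ≤⟨ +-mono-≤ (*-monoˡ-≤ (weight rest i) (misses-weight S i short)) (average-potential S {rest = rest} p short Is) ⟩
    length S * weight S i * weight rest i + length S * potential free Is   ≡⟨ cong (_+ length S * potential free Is) (trans (*-assoc (length S) _ _) (cong (length S *_) split)) ⟩
    length S * weight free i + length S * potential free Is        ≡⟨ *-distribˡ-+ (length S) (weight free i) _ ⟨
    length S * (weight free i + potential free Is)                 ∎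
    where
    open ≤-Reasoning
    Q = suc q ^ length S
    total = sum (map (λ e → potential rest (survivors e Is)) S)
    split : weight S i * weight rest i ≡ weight free i
    split = trans (sym (weight-++ S rest i)) (sym (weight-↭ i p))
    expand : ∀ m w t Q → (m * w + t) * Q ≡ m * Q * w + t * Q
    expand = solve-∀

  module _ {P : List (Edge n) → Set} {Is₀ : List I} (allHit : ∀ {client} → (∀ {i} → i ∈ Is₀ → Any (Hit i) client) → P client) where

    -- The last hypothesis says that the normalised total weight is below 1. When no edge is free, a
    -- surviving target weighs 1, so none survives. The number `m` is fuel.
    clientHitsAll : ∀ m {free client} → length free ≤ m → Unique free → ∀ Is →
      (∀ {i} → i ∈ Is₀ → i ∈ Is ⊎ Any (Hit i) client) →
      potential free Is < suc q ^ length free → ClientWins q P free client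
    clientHitsAll m {[]} {client} _ _ [] alive _ = done (allHit hit)
      where
      hit : ∀ {i} → i ∈ Is₀ → Any (Hit i) client
      hit i∈ with alive i∈
      ... | inj₂ h = h
    clientHitsAll m {[]} _ _ (i ∷ Is) alive (s≤s ())
    clientHitsAll (suc m) {free@(_ ∷ _)} {client} (s≤s len) uf Is alive small = move reply
      where
      reply : (S : Offer q free) → Σ (Edge n) λ e → e ∈ edges S × ClientWins q P (removeOffered (edges S) free) (e ∷ client)
      reply (offer S uS S⊆ ne short)
        with rest ← removeOffered S free in eq
        with perm ← subst (λ r → free ↭ S ++ r) eq (removeOffered-↭ uS uf S⊆)
        with lenFree ← trans (Perm.↭-length perm) (length-++ S {rest})
        with ∃-below-average (λ e → potential rest (survivors e Is)) (suc q ^ length rest) S below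
        where
        below : sum (map (λ e → potential rest (survivors e Is)) S) < length S * suc q ^ length rest
        below = *-cancelʳ-< (suc q ^ length S) _ _ (begin-strict
          sum (map (λ e → potential rest (survivors e Is)) S) * suc q ^ length S  ≤⟨ average-potential S perm short Is ⟩
          length S * potential free Is                                            <⟨ *-monoʳ-< (length S) {{>-nonZero ne}} small ⟩
          length S * suc q ^ length free                                          ≡⟨ cong (λ l → length S * suc q ^ l) lenFree ⟩
          length S * suc q ^ (length S + length rest)                             ≡⟨ cong (length S *_) (^-distribˡ-+-* (suc q) (length S) (length rest)) ⟩
          length S * (suc q ^ length S * suc q ^ length rest)                     ≡⟨ rearrange (length S) (suc q ^ length S) _ ⟩
          length S * suc q ^ length rest * suc q ^ length S                       ∎)
          where
          open ≤-Reasoning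
          rearrange : ∀ a b c → a * (b * c) ≡ a * c * b
          rearrange = solve-∀
      ... | e , e∈ , small′ = e , e∈ ,
        clientHitsAll m {rest} (≤-trans (≤-pred (≤-trans (+-monoˡ-≤ (length rest) ne) (≤-reflexive (sym lenFree)))) len)
          (subst Unique eq (Unique.filter⁺ (λ e′ → ¬? (mem? _≟ₑ_ e′ S)) uf))
          (survivors e Is) alive′ small′
        where
        alive′ : ∀ {i} → i ∈ Is₀ → i ∈ survivors e Is ⊎ Any (Hit i) (e ∷ client)
        alive′ {i} i∈ with alive i∈ | hit? i e
        ... | inj₂ h   | _      = inj₂ (there h)
        ... | inj₁ _   | yes h  = inj₂ (here h)
        ... | inj₁ i∈s | no ¬h  = inj₁ (∈-filter⁺ (λ i → ¬? (hit? i e)) i∈s ¬h)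

-- Counting the monochromatic edges of a colouring

𝟙 : ∀ {p} {P : Set p} → Dec P → ℕ
𝟙 (yes _) = 1
𝟙 (no  _) = 0

∑-mono-≤ : ∀ {m} {f g : Fin m → ℕ} → (∀ i → f i ≤ g i) → ∑ f ≤ ∑ g
∑-mono-≤ {zero}  f≤g = z≤n
∑-mono-≤ {suc m} f≤g = +-mono-≤ (f≤g Fin.zero) (∑-mono-≤ (f≤g ∘ Fin.suc))

∑-const : ∀ m x → ∑ {m} (λ _ → x) ≡ m * x
∑-const zero    x = refl
∑-const (suc m) x = cong (x +_) (∑-const m x)

𝟙-suc : ∀ {m} (i a : Fin m) → 𝟙 (Fin.suc i Fin.≟ Fin.suc a) ≡ 𝟙 (i Fin.≟ a)
𝟙-suc i a with i Fin.≟ a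
... | yes _ = refl
... | no  _ = refl

∑-𝟙 : ∀ {m} (i : Fin m) (g : Fin m → ℕ) → ∑ (λ a → 𝟙 (i Fin.≟ a) * g a) ≡ g i
∑-𝟙 {suc m} Fin.zero g = trans (cong₂ _+_ (+-identityʳ (g Fin.zero)) (trans (∑-const m 0) (*-zeroʳ m))) (+-identityʳ _)
∑-𝟙 {suc m} (Fin.suc i) g = trans (∑-cong (λ a → cong (_* g (Fin.suc a)) (𝟙-suc i a))) (∑-𝟙 i (g ∘ Fin.suc))

2xy≤x²+y² : ∀ x y → 2 * (x * y) ≤ x * x + y * y
2xy≤x²+y² x y with ≤-total x y
... | inj₁ x≤y with m≤n⇒∃[o]m+o≡n x≤y
... | d , refl = ≤-trans (m≤m+n _ (d * d)) (≤-reflexive (square x d))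
  where
  square : ∀ x d → 2 * (x * (x + d)) + d * d ≡ x * x + (x + d) * (x + d)
  square = solve-∀
2xy≤x²+y² x y | inj₂ y≤x with m≤n⇒∃[o]m+o≡n y≤x
... | d , refl = ≤-trans (m≤m+n _ (d * d)) (≤-reflexive (square y d))
  where
  square : ∀ x d → 2 * ((x + d) * x) + d * d ≡ (x + d) * (x + d) + x * x
  square = solve-∀

-- Doubled and expanded into double sums, the inequality is `2xy≤x²+y²` for each pair of indices.
cauchy-schwarz : ∀ {k} (N : Fin k → ℕ) → ∑ N * ∑ N ≤ k * ∑ (λ a → N a * N a)
cauchy-schwarz {k} N = *-cancelˡ-≤ 2 (begin
  2 * (∑ N * ∑ N)                                  ≡⟨ cong (2 *_) (*-distribʳ-sum (∑ N) N) ⟩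
  2 * ∑ (λ a → N a * ∑ N)                          ≡⟨ *-distribˡ-sum 2 (λ a → N a * ∑ N) ⟩
  ∑ (λ a → 2 * (N a * ∑ N))                        ≡⟨ ∑-cong (λ a → trans (cong (2 *_) (*-distribˡ-sum (N a) N)) (*-distribˡ-sum 2 (λ b → N a * N b))) ⟩
  ∑ (λ a → ∑ (λ b → 2 * (N a * N b)))              ≤⟨ ∑-mono-≤ (λ a → ∑-mono-≤ (λ b → 2xy≤x²+y² (N a) (N b))) ⟩
  ∑ (λ a → ∑ (λ b → N a * N a + N b * N b))        ≡⟨ ∑-cong (λ a → trans (∑-distrib-+ (λ _ → N a * N a) (λ b → N b * N b)) (cong (_+ X) (∑-const k _))) ⟩
  ∑ (λ a → k * (N a * N a) + X)                    ≡⟨ ∑-distrib-+ (λ a → k * (N a * N a)) (λ _ → X) ⟩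
  ∑ (λ a → k * (N a * N a)) + ∑ {k} (λ _ → X)      ≡⟨ cong₂ _+_ (sym (*-distribˡ-sum k (λ a → N a * N a))) (∑-const k X) ⟩
  k * X + k * X                                    ≡⟨ cong (k * X +_) (+-identityʳ (k * X)) ⟨
  2 * (k * X)                                      ∎)
  where
  open ≤-Reasoning
  X = ∑ (λ a → N a * N a)

Mono : ∀ {n k} → (Fin n → Fin k) → Edge n → Set
Mono c e = c (proj₁ e) ≡ c (proj₂ e)

mono? : ∀ {n k} (c : Fin n → Fin k) → Decidable (Mono c)
mono? c e = c (proj₁ e) Fin.≟ c (proj₂ e)

module _ {n k : ℕ} (c : Fin n → Fin k) where

  -- The ordered monochromatic pairs, loops included, number Σ N_a² over the class sizes N_a, which
  -- add up to n.
  classes : n * n ≤ k * ∑ (λ i → ∑ (λ j → 𝟙 (c i Fin.≟ c j)))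
  classes = begin
    n * n                                                       ≡⟨ cong₂ _*_ total total ⟨
    ∑ N * ∑ N                                                   ≤⟨ cauchy-schwarz N ⟩
    k * ∑ (λ a → N a * N a)                                     ≡⟨ cong (k *_) (∑-cong λ a → *-distribʳ-sum (N a) (λ j → 𝟙 (c j Fin.≟ a))) ⟩
    k * ∑ (λ a → ∑ (λ j → 𝟙 (c j Fin.≟ a) * N a))               ≡⟨ cong (k *_) (∑-comm (λ a j → 𝟙 (c j Fin.≟ a) * N a)) ⟩
    k * ∑ (λ j → ∑ (λ a → 𝟙 (c j Fin.≟ a) * N a))               ≡⟨ cong (k *_) (∑-cong λ j → ∑-𝟙 (c j) N) ⟩
    k * ∑ (λ j → ∑ (λ i → 𝟙 (c i Fin.≟ c j)))                   ≡⟨ cong (k *_) (∑-comm (λ j i → 𝟙 (c i Fin.≟ c j))) ⟩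
    k * ∑ (λ i → ∑ (λ j → 𝟙 (c i Fin.≟ c j)))                   ∎
    where
    open ≤-Reasoning
    N : Fin k → ℕ
    N a = ∑ (λ j → 𝟙 (c j Fin.≟ a))
    total : ∑ N ≡ n
    total = trans (∑-comm (λ a j → 𝟙 (c j Fin.≟ a)))
      (trans (∑-cong λ j → trans (∑-cong λ a → sym (*-identityʳ (𝟙 (c j Fin.≟ a)))) (∑-𝟙 (c j) (λ _ → 1)))
      (trans (∑-const n 1) (*-identityʳ n)))

  -- Defined on arbitrary lists of pairs, so that `edgesK n`, a filtered list of all ordered pairs,
  -- can be counted as a double sum.
  count : List (Edge n) → ℕ
  count es = length (filter (mono? c) (filter forward? es))

  count-++ : ∀ es fs → count (es ++ fs) ≡ count es + count fs
  count-++ es fs = trans (cong (λ xs → length (filter (mono? c) xs)) (filter-++ forward? es fs))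
    (trans (cong length (filter-++ (mono? c) (filter forward? es) _)) (length-++ (filter (mono? c) (filter forward? es))))

  count-row : ∀ {m} i (f : Fin m → Fin n) → count (map (i ,_) (tabulate f)) ≡ ∑ (λ j → count ((i , f j) ∷ []))
  count-row {zero}  i f = refl
  count-row {suc m} i f = trans (count-++ ((i , f Fin.zero) ∷ []) _) (cong (count ((i , f Fin.zero) ∷ []) +_) (count-row i (f ∘ Fin.suc)))

  count-rows : ∀ {m} (f : Fin m → Fin n) → count (concatMap (λ i → map (i ,_) (allFin n)) (tabulate f)) ≡
    ∑ (λ i → ∑ (λ j → count ((f i , j) ∷ [])))
  count-rows {zero}  f = refl
  count-rows {suc m} f = trans (count-++ (map (f Fin.zero ,_) (allFin n)) _) (cong₂ _+_ (count-row (f Fin.zero) (λ j → j)) (count-rows (f ∘ Fin.suc)))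

  count-edge : ∀ {i j} → toℕ i < toℕ j → c i ≡ c j → count ((i , j) ∷ []) ≡ 1
  count-edge i<j eq = cong length (trans (cong (filter (mono? c)) (filter-accept forward? {xs = []} i<j)) (filter-accept (mono? c) {xs = []} eq))

  monochromatic-pair : ∀ i j → 𝟙 (c i Fin.≟ c j) ≤ 𝟙 (i Fin.≟ j) * 1 + (count ((i , j) ∷ []) + count ((j , i) ∷ []))
  monochromatic-pair i j with c i Fin.≟ c j
  ... | no _ = z≤n
  ... | yes eq with i Fin.≟ j
  ... | yes _ = s≤s z≤n
  ... | no i≢j with <-cmp (toℕ i) (toℕ j)
  ... | tri≈ _ i≡j _ = contradiction (Fin.toℕ-injective i≡j) i≢j
  ... | tri< i<j _ _ = ≤-trans (≤-reflexive (sym (count-edge i<j eq))) (m≤m+n _ _)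
  ... | tri> _ _ j<i = ≤-trans (≤-reflexive (sym (count-edge j<i (sym eq)))) (m≤n+m _ (count ((i , j) ∷ [])))

  -- Of the ordered monochromatic pairs n are loops, and each monochromatic edge accounts for two.
  monochromatic-edges : n * n ≤ k * (n + 2 * length (filter (mono? c) (edgesK n)))
  monochromatic-edges = ≤-trans classes (*-monoʳ-≤ k (begin
    ∑ (λ i → ∑ (λ j → 𝟙 (c i Fin.≟ c j)))                                 ≤⟨ ∑-mono-≤ (λ i → ∑-mono-≤ (monochromatic-pair i)) ⟩
    ∑ (λ i → ∑ (λ j → 𝟙 (i Fin.≟ j) * 1 + (e i j + e j i)))               ≡⟨ ∑-cong (λ i → trans (∑-distrib-+ (λ j → 𝟙 (i Fin.≟ j) * 1) (λ j → e i j + e j i)) (cong₂ _+_ (∑-𝟙 i (λ _ → 1)) (∑-distrib-+ (e i) (λ j → e j i)))) ⟩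
    ∑ (λ i → 1 + (∑ (e i) + ∑ (λ j → e j i)))                             ≡⟨ ∑-distrib-+ (λ _ → 1) (λ i → ∑ (e i) + ∑ (λ j → e j i)) ⟩
    ∑ {n} (λ _ → 1) + ∑ (λ i → ∑ (e i) + ∑ (λ j → e j i))                 ≡⟨ cong₂ _+_ (trans (∑-const n 1) (*-identityʳ n)) (∑-distrib-+ (λ i → ∑ (e i)) (λ i → ∑ (λ j → e j i))) ⟩
    n + (∑ (λ i → ∑ (e i)) + ∑ (λ i → ∑ (λ j → e j i)))                   ≡⟨ cong (λ x → n + (∑ (λ i → ∑ (e i)) + x)) (∑-comm (λ i j → e j i)) ⟩
    n + (∑ (λ i → ∑ (e i)) + ∑ (λ i → ∑ (e i)))                           ≡⟨ cong₂ (λ x y → n + (x + y)) total (trans total (sym (+-identityʳ _))) ⟩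
    n + 2 * length (filter (mono? c) (edgesK n))                          ∎))
    where
    open ≤-Reasoning
    e : Fin n → Fin n → ℕ
    e i j = count ((i , j) ∷ [])
    total : ∑ (λ i → ∑ (e i)) ≡ length (filter (mono? c) (edgesK n))
    total = sym (count-rows (λ i → i))

-- All colourings as Client's targets

colorings : ∀ n k → List (Vec (Fin k) n)
colorings zero    k = Vec.[] ∷ []
colorings (suc n) k = cartesianProductWith Vec._∷_ (allFin k) (colorings n k)

length-cartesianProductWith : ∀ {A B C : Set} (f : A → B → C) xs ys → length (cartesianProductWith f xs ys) ≡ length xs * length ys
length-cartesianProductWith f []       ys = refl
length-cartesianProductWith f (x ∷ xs) ys =
  trans (length-++ (map (f x) ys)) (cong₂ _+_ (length-map (f x) ys) (length-cartesianProductWith f xs ys))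

length-colorings : ∀ n k → length (colorings n k) ≡ k ^ n
length-colorings zero    k = refl
length-colorings (suc n) k = trans (length-cartesianProductWith Vec._∷_ (allFin k) (colorings n k))
  (cong₂ _*_ (length-tabulate {n = k} (λ i → i)) (length-colorings n k))

-- The reason for vectors: membership is up to propositional equality, which for functions would
-- call for extensionality.
∈-colorings : ∀ {n k} (c : Vec (Fin k) n) → c ∈ colorings n k
∈-colorings Vec.[]      = here refl
∈-colorings (a Vec.∷ c) = ∈-cartesianProductWith⁺ Vec._∷_ (∈-allFin a) (∈-colorings c)

sum-< : ∀ {A : Set} (f : A → ℕ) K {B} → 0 < B → 0 < K → ∀ xs → length xs ≤ K → (∀ x → K * f x < B) → sum (map f xs) < B
sum-< f K@(suc _) {suc b} _ _ xs short small = s≤s (*-cancelˡ-≤ K (≤-trans (total xs) (*-monoˡ-≤ b short)))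
  where
  total : ∀ xs → K * sum (map f xs) ≤ length xs * b
  total []       = ≤-reflexive (*-zeroʳ K)
  total (x ∷ xs) = ≤-trans (≤-reflexive (*-distribˡ-+ K (f x) _)) (+-mono-≤ (≤-pred (small x)) (total xs))

double-power : ∀ q → 1 ≤ q → 2 * q ^ q ≤ suc q ^ q
double-power q@(suc _) _ = *-cancelˡ-≤ q (≤-trans (≤-reflexive (twice q (q ^ q))) (bernoulli q q))
  where
  twice : ∀ q x → q * (2 * x) ≡ (q + q) * x
  twice = solve-∀

^-distrib-* : ∀ x y m → (x * y) ^ m ≡ x ^ m * y ^ m
^-distrib-* x y zero    = refl
^-distrib-* x y (suc m) = trans (cong (x * y *_) (^-distrib-* x y m)) (swap x y (x ^ m) (y ^ m))
  where
  swap : ∀ a b c d → a * b * (c * d) ≡ a * c * (b * d)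
  swap = solve-∀

-- The (2kq)-th power of the claim; 2kf ≥ n² − kn and (1 + 1/q)^q ≥ 2.
colorings-beat : ∀ n k q f → 1 ≤ n → 1 ≤ q → n * n ≤ k * (n + 2 * f) → 2 ^ k * k ^ (2 * q * k) < 2 ^ n →
  k ^ n * q ^ f < suc q ^ f
colorings-beat n k q f 1≤n 1≤q n² sparse with k ^ n * q ^ f <? suc q ^ f
... | yes p = p
... | no ¬p = contradiction (begin-strict
  b ^ n * D                          <⟨ *-monoˡ-< D {{D≢0}} b^n< ⟩
  2 ^ (2 * k * f) * D                ≡⟨ ^-distrib-* 2 (q ^ q) (2 * k * f) ⟨
  (2 * q ^ q) ^ (2 * k * f)          ≤⟨ ^-monoˡ-≤ (2 * k * f) (double-power q 1≤q) ⟩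
  (suc q ^ q) ^ (2 * k * f)          ≡⟨ trans (^-*-assoc (suc q) q (2 * k * f)) (trans (cong (suc q ^_) (rearrange q k f)) (sym (^-*-assoc (suc q) f X))) ⟩
  (suc q ^ f) ^ X                    ≤⟨ ^-monoˡ-≤ X (≮⇒≥ ¬p) ⟩
  (k ^ n * q ^ f) ^ X                ≡⟨ ^-distrib-* (k ^ n) (q ^ f) X ⟩
  (k ^ n) ^ X * (q ^ f) ^ X          ≡⟨ cong₂ _*_ (trans (^-*-assoc k n X) (trans (cong (k ^_) (*-comm n X)) (sym (^-*-assoc k X n))))
                                          (trans (^-*-assoc q f X) (trans (cong (q ^_) (sym (rearrange q k f))) (sym (^-*-assoc q q (2 * k * f))))) ⟩
  b ^ n * D                          ∎) (<-irrefl refl)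
  where
  open ≤-Reasoning
  X = 2 * q * k
  b = k ^ X
  D = (q ^ q) ^ (2 * k * f)
  D≢0 : NonZero D
  D≢0 = m^n≢0 (q ^ q) (2 * k * f) {{m^n≢0 q q {{>-nonZero 1≤q}}}}
  rearrange : ∀ q k f → q * (2 * k * f) ≡ f * (2 * q * k)
  rearrange = solve-∀
  split : ∀ k n f → k * (n + 2 * f) ≡ k * n + 2 * k * f
  split = solve-∀
  b^n< : b ^ n < 2 ^ (2 * k * f)
  -- The factor 2^(kn) turns n² - kn into n²; it is the n-th power of the 2^k in `sparse`.
  b^n< = *-cancelˡ-< (2 ^ (k * n)) _ _ (begin-strict
    2 ^ (k * n) * b ^ n              ≡⟨ cong (_* b ^ n) (^-*-assoc 2 k n) ⟨
    (2 ^ k) ^ n * b ^ n              ≡⟨ ^-distrib-* (2 ^ k) b n ⟨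
    (2 ^ k * b) ^ n                  <⟨ ^-monoˡ-< n {{>-nonZero 1≤n}} sparse ⟩
    (2 ^ n) ^ n                      ≡⟨ ^-*-assoc 2 n n ⟩
    2 ^ (n * n)                      ≤⟨ ^-monoʳ-≤ 2 n² ⟩
    2 ^ (k * (n + 2 * f))            ≡⟨ cong (2 ^_) (split k n f) ⟩
    2 ^ (k * n + 2 * k * f)          ≡⟨ ^-distribˡ-+-* 2 (k * n) (2 * k * f) ⟩
    2 ^ (k * n) * 2 ^ (2 * k * f)    ∎)

-- In logarithms the last hypothesis reads 2qk log k < (n - k) log 2: the bound on q with constant
-- log 2/2, up to a correction for the loops.
clientSpoils : ∀ n k q → 1 ≤ n → 1 ≤ k → 1 ≤ q → 2 ^ k * k ^ (2 * q * k) < 2 ^ n →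
  ClientCanEnsure n q (λ G → ¬ Colorable k G)
clientSpoils n k q 1≤n 1≤k 1≤q sparse =
  clientHitsAll uncolorable (length (edgesK n)) ≤-refl (edgesK-unique n) (colorings n k) inj₁ small
  where
  open Targets {n} {q} {Vec (Fin k) n} (λ c → mono? (Vec.lookup c))
  uncolorable : ∀ {client} → (∀ {c} → c ∈ colorings n k → Any (Mono (Vec.lookup c)) client) → ¬ Colorable k client
  uncolorable hit (c , proper) with find (hit (∈-colorings (Vec.tabulate c)))
  ... | (i , j) , e∈ , eq = All.lookup proper e∈
    (trans (sym (Vec.lookup∘tabulate c i)) (trans eq (Vec.lookup∘tabulate c j)))
  small : potential (edgesK n) (colorings n k) < suc q ^ length (edgesK n)
  small = sum-< (weight (edgesK n)) (k ^ n) (m^n>0 (suc q) (length (edgesK n))) (m^n>0 k {{>-nonZero 1≤k}} n) (colorings n k)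
    (≤-reflexive (length-colorings n k)) each
    where
    open ≤-Reasoning
    each : ∀ c → k ^ n * weight (edgesK n) c < suc q ^ length (edgesK n)
    each c = begin-strict
      k ^ n * weight (edgesK n) c                   ≡⟨ cong (k ^ n *_) (weight≡ (edgesK n) c) ⟩
      k ^ n * (q ^ f * suc q ^ g)                   ≡⟨ *-assoc (k ^ n) _ _ ⟨
      k ^ n * q ^ f * suc q ^ g                     <⟨ *-monoˡ-< (suc q ^ g) {{m^n≢0 (suc q) g}} (colorings-beat n k q f 1≤n 1≤q (monochromatic-edges (Vec.lookup c)) sparse) ⟩
      suc q ^ f * suc q ^ g                         ≡⟨ ^-distribˡ-+-* (suc q) f g ⟨
      suc q ^ (f + g)                               ≡⟨ cong (suc q ^_) (length-filter-partition (mono? (Vec.lookup c)) (edgesK n)) ⟩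
      suc q ^ length (edgesK n)                     ∎
      where
      f = hits (edgesK n) c
      g = misses (edgesK n) c

-- Upper approximations of the logarithm

-- p/q for q ≥ 1 (and p for the junk value q = 0)
frac : ℕ → ℕ → ℚᵘ
frac p q = mkℚᵘ (ℤ.+ p) (pred q)

frac-≤ : ∀ p q r s .{{_ : NonZero q}} .{{_ : NonZero s}} → p * s ≤ r * q → frac p q Q.≤ frac r s
frac-≤ p (suc q) r (suc s) h = *≤* (subst₂ ℤ._≤_ (ℤ.pos-* p (suc s)) (ℤ.pos-* r (suc q)) (+≤+ h))

frac-< : ∀ p q r s .{{_ : NonZero q}} .{{_ : NonZero s}} → p * s < r * q → frac p q Q.< frac r s
frac-< p (suc q) r (suc s) h = *<* (subst₂ ℤ._<_ (ℤ.pos-* p (suc s)) (ℤ.pos-* r (suc q)) (+<+ h))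

frac-≤⁻ : ∀ p q r s .{{_ : NonZero q}} .{{_ : NonZero s}} → frac p q Q.≤ frac r s → p * s ≤ r * q
frac-≤⁻ p (suc q) r (suc s) (*≤* h) = ℤ.drop‿+≤+ (subst₂ ℤ._≤_ (sym (ℤ.pos-* p (suc s))) (sym (ℤ.pos-* r (suc q))) h)

frac-* : ∀ p q r s .{{_ : NonZero q}} .{{_ : NonZero s}} → frac p q Q.* frac r s ≡ frac (p * r) (q * s)
frac-* p (suc q) r (suc s) = cong (λ x → mkℚᵘ x _) (sym (ℤ.pos-* p r))

frac-+ : ∀ p q r s .{{_ : NonZero q}} .{{_ : NonZero s}} → frac p q Q.+ frac r s ≡ frac (p * s + r * q) (q * s)
frac-+ p (suc q) r (suc s) = cong (λ x → mkℚᵘ x _)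
  (trans (cong₂ ℤ._+_ (sym (ℤ.pos-* p (suc s))) (sym (ℤ.pos-* r (suc q)))) (sym (ℤ.pos-+ (p * suc s) _)))

powQ-frac : ∀ p q .{{_ : NonZero q}} m → powQ (frac p q) m ≡ frac (p ^ m) (q ^ m)
powQ-frac p q zero    = refl
powQ-frac p q {{q≢0}} (suc m) = trans (cong (frac p q Q.*_) (powQ-frac p q m)) (frac-* p q (p ^ m) (q ^ m) {{q≢0}} {{m^n≢0 q m}})

logY-≥ : ∀ {a b} → b ≤ a → logY a b ≡ frac (a ∸ b) (a + b)
logY-≥ {a} {b} b≤a = cong (λ x → mkℚᵘ x (pred (a + b))) (trans (ℤ.m-n≡m⊖n a b) (ℤ.⊖-≥ b≤a))

∣logY∣-≥ : ∀ {a b} → b ≤ a → Q.∣ logY a b ∣ ≡ frac (a ∸ b) (a + b)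
∣logY∣-≥ b≤a = cong Q.∣_∣ (logY-≥ b≤a)

∣logY∣-< : ∀ {a b} → a < b → Q.∣ logY a b ∣ ≡ frac (b ∸ a) (a + b)
∣logY∣-< {a} {b} a<b = cong (λ x → mkℚᵘ (ℤ.+ x) (pred (a + b))) (trans (cong ℤ.∣_∣ (ℤ.m-n≡m⊖n a b)) (ℤ.∣⊖∣-< a<b))

logY-nonPos : ∀ {a b} → a < b → Q.NonPositive (logY a b)
logY-nonPos {a} {b} a<b = subst (λ x → Q.NonPositive (mkℚᵘ x (pred (a + b)))) (sym (trans (ℤ.m-n≡m⊖n a b) (ℤ.⊖-< a<b))) (neg (b ∸ a))
  where
  neg : ∀ m → Q.NonPositive (mkℚᵘ (ℤ.- (ℤ.+ m)) (pred (a + b)))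
  neg zero    = _
  neg (suc m) = _

powQ-odd-nonPos : ∀ y .{{_ : Q.NonPositive y}} j → powQ y (suc (2 * j)) Q.≤ 0ℚᵘ
powQ-odd-nonPos y zero    = Q.≤-trans (Q.≤-reflexive (Q.*-identityʳ y)) (Q.nonPositive⁻¹ y)
powQ-odd-nonPos y (suc j) rewrite +-suc j (j + 0) = Q.≤-trans (Q.*-monoʳ-≤-nonPos y
  (Q.≤-trans (Q.≤-reflexive (Q.≃-sym (Q.*-zeroʳ y))) (Q.*-monoʳ-≤-nonPos y (powQ-odd-nonPos y j)))) (Q.≤-reflexive (Q.*-zeroʳ y))

logS-nonPos : ∀ {a b} → a < b → ∀ N → logS a b N Q.≤ 0ℚᵘ
logS-nonPos a<b zero    = Q.≤-refl
logS-nonPos {a} {b} a<b (suc N) = Q.≤-trans (Q.+-mono-≤ (logS-nonPos a<b N)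
  (Q.≤-trans (Q.*-monoʳ-≤-nonNeg (mkℚᵘ (ℤ.+ 2) (2 * N)) (powQ-odd-nonPos (logY a b) {{logY-nonPos a<b}} N)) (Q.≤-reflexive (Q.*-zeroʳ (mkℚᵘ (ℤ.+ 2) (2 * N))))))
  (Q.≤-reflexive (Q.+-identityʳ 0ℚᵘ))

logE-frac : ∀ a b u .{{_ : NonZero a}} .{{_ : NonZero b}} → Q.∣ logY a b ∣ ≡ frac u (a + b) → ∀ N →
  logE a b N ≡ frac ((a + b) ^ 2 * u ^ suc (2 * N)) (2 * a * b * (a + b) ^ suc (2 * N))
logE-frac a@(suc _) b@(suc _) u eq N = trans
  (cong (frac ((a + b) ^ 2) (2 * a * b) Q.*_) (trans (cong (λ y → powQ y (suc (2 * N))) eq) (powQ-frac u (a + b) (suc (2 * N)))))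
  (frac-* ((a + b) ^ 2) (2 * a * b) (u ^ suc (2 * N)) ((a + b) ^ suc (2 * N)) {{_}} {{m^n≢0 (a + b) (suc (2 * N))}})

-- The partial sum is empty, so U_0 is the error term (a² - b²)/(2ab), which is at most a/(2b).
logU₀-≤ : ∀ {a b} B .{{_ : NonZero a}} .{{_ : NonZero b}} → b ≤ a → a ≤ B * b → logU a b 0 Q.≤ frac B 2
logU₀-≤ {a@(suc _)} {b@(suc _)} B b≤a a≤Bb = Q.≤-trans (Q.≤-reflexive (Q.+-identityˡ _))
  (Q.≤-trans (Q.≤-reflexive-≡ (logE-frac a b (a ∸ b) (∣logY∣-≥ b≤a) 0))
    (frac-≤ ((a + b) ^ 2 * (a ∸ b) ^ 1) (2 * a * b * (a + b) ^ 1) B 2 {{m*n≢0 (2 * a * b) ((a + b) ^ 1)}} bound))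
  where
  open ≤-Reasoning
  factorˡ : ∀ s u → s * (s * 1) * (u * 1) * 2 ≡ 2 * s * (s * u)
  factorˡ = solve-∀
  factorʳ : ∀ s a b B → 2 * s * (a * (B * b)) ≡ B * (2 * a * b * (s * 1))
  factorʳ = solve-∀
  squares : (a + b) * (a ∸ b) ≤ a * a
  squares with m≤n⇒∃[o]m+o≡n b≤a
  ... | d , eq = subst (λ x → (x + b) * (x ∸ b) ≤ x * x) eq (begin
    (b + d + b) * (b + d ∸ b)          ≡⟨ cong ((b + d + b) *_) (m+n∸m≡n b d) ⟩
    (b + d + b) * d                    ≤⟨ m≤m+n _ (b * b) ⟩
    (b + d + b) * d + b * b            ≡⟨ expand b d ⟩
    (b + d) * (b + d)                  ∎)
    where
    expand : ∀ b d → (b + d + b) * d + b * b ≡ (b + d) * (b + d)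
    expand = solve-∀
  bound : (a + b) ^ 2 * (a ∸ b) ^ 1 * 2 ≤ B * (2 * a * b * (a + b) ^ 1)
  bound = begin
    (a + b) ^ 2 * (a ∸ b) ^ 1 * 2        ≡⟨ factorˡ (a + b) (a ∸ b) ⟩
    2 * (a + b) * ((a + b) * (a ∸ b))    ≤⟨ *-monoʳ-≤ (2 * (a + b)) (≤-trans squares (*-monoʳ-≤ a a≤Bb)) ⟩
    2 * (a + b) * (a * (B * b))          ≡⟨ factorʳ (a + b) a b B ⟩
    B * (2 * a * b * (a + b) ^ 1)        ∎

-- For a < b the series is negative, and by Bernoulli the error term is at most 1 from N = (b − a)(a + b)² on.
logU-≤1 : ∀ {a b} .{{_ : NonZero a}} → a < b → ∃ λ N → logU a b N Q.≤ 1ℚᵘ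
logU-≤1 {a@(suc _)} {b@(suc _)} a<b = N , (begin
  logU a b N                                                           ≤⟨ Q.+-monoˡ-≤ (logE a b N) (logS-nonPos a<b N) ⟩
  0ℚᵘ Q.+ logE a b N                                                   ≃⟨ Q.+-identityˡ _ ⟩
  logE a b N                                                           ≡⟨ logE-frac a b u (∣logY∣-< a<b) N ⟩
  frac ((a + b) ^ 2 * u ^ m) (2 * a * b * (a + b) ^ m)                 ≤⟨ frac-≤ ((a + b) ^ 2 * u ^ m) (2 * a * b * (a + b) ^ m) 1 1 {{m*n≢0 (2 * a * b) ((a + b) ^ m) {{_}} {{m^n≢0 (a + b) m}}}} bound ⟩
  1ℚᵘ                                                                  ∎)
  where
  open Q.≤-Reasoning
  u = b ∸ a
  N = u * (a + b) ^ 2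
  m = suc (2 * N)
  u≢0 : NonZero u
  u≢0 = >-nonZero (m<n⇒0<n∸m a<b)
  bound : (a + b) ^ 2 * u ^ m * 1 ≤ 1 * (2 * a * b * (a + b) ^ m)
  bound = ≤-trans (≤-reflexive (*-identityʳ _)) (≤-trans (*-cancelˡ-≤ u {{u≢0}} step)
    (≤-trans (m≤n*m _ (2 * a * b)) (≤-reflexive (sym (*-identityˡ _)))))
    where
    step : u * ((a + b) ^ 2 * u ^ m) ≤ u * (a + b) ^ m
    step = ≤-trans (≤-reflexive (sym (*-assoc u _ (u ^ m))))
      (≤-trans (*-monoˡ-≤ (u ^ m) (≤-trans (m≤m+n N (N + 0)) (≤-trans (n≤1+n _) (m≤n+m m u))))
      (≤-trans (bernoulli u m) (*-monoʳ-≤ u (^-monoˡ-≤ m (≤-trans (s≤s (m∸n≤m b a)) (m<n+m b (s≤s z≤n)))))))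

-- The contrapositive is proved: if a ≤ 2^k b, some upper approximation of log(a/b) is at most 2^k.
exp-bound : ∀ {r a b} k .{{_ : NonZero a}} .{{_ : NonZero b}} → frac (2 ^ k) 1 Q.< r → LeMulLog r (ℕ→Q 1) a b → 2 ^ k * b < a
exp-bound {r} {a} {b} k 2^k<r le with 2 ^ k * b <? a
... | yes p = p
... | no ¬p = contradiction (proj₁ small , Q.≤-<-trans (Q.≤-reflexive (Q.*-identityˡ _)) (Q.≤-<-trans (proj₂ small) 2^k<r)) le
  where
  small : ∃ λ N → logU a b N Q.≤ frac (2 ^ k) 1
  small with b ≤? a
  ... | yes b≤a = 0 , Q.≤-trans (logU₀-≤ (2 ^ k) b≤a (≮⇒≥ ¬p)) (frac-≤ (2 ^ k) 2 (2 ^ k) 1 (*-monoʳ-≤ (2 ^ k) (s≤s z≤n)))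
  ... | no  b≰a with logU-≤1 (≰⇒> b≰a)
  ... | N , U≤1 = N , Q.≤-trans U≤1 (frac-≤ 1 1 (2 ^ k) 1 (*-monoˡ-≤ 1 (m^n>0 2 k)))

-- Harmonic sums

m<suc[m/n]*n : ∀ m n .{{_ : NonZero n}} → m < suc (m / n) * n
m<suc[m/n]*n m n = ≤-<-trans (≤-reflexive (m≡m%n+[m/n]*n m n)) (+-monoˡ-< (m / n * n) (m%n<n m n))

H : ℕ → ℚᵘ
H zero    = 0ℚᵘ
H (suc n) = H n Q.+ frac 1 (suc n)

frac-+-same : ∀ p r q .{{_ : NonZero q}} → frac p q Q.+ frac r q Q.≃ frac (p + r) q
frac-+-same p r q {{q≢0}} = Q.≃-trans (Q.≃-reflexive (frac-+ p q r q)) (Q.≤-antisym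
  (frac-≤ (p * q + r * q) (q * q) (p + r) q {{m*n≢0 q q}} (≤-reflexive (same p r q)))
  (frac-≤ (p + r) q (p * q + r * q) (q * q) {{q≢0}} {{m*n≢0 q q}} (≤-reflexive (sym (same p r q)))))
  where
  same : ∀ p r q → (p * q + r * q) * q ≡ (p + r) * (q * q)
  same = solve-∀

H-+-≤ : ∀ m a d .{{_ : NonZero d}} → d ≤ suc m → H (m + a) Q.≤ H m Q.+ frac a d
H-+-≤ m zero    d d≤ rewrite +-identityʳ m = Q.p≤p+q (H m) (frac 0 d)
H-+-≤ m (suc a) d d≤ rewrite +-suc m a = begin
  H (m + a) Q.+ frac 1 (suc (m + a))       ≤⟨ Q.+-mono-≤ (H-+-≤ m a d d≤) (frac-≤ 1 (suc (m + a)) 1 d (*-monoʳ-≤ 1 (≤-trans d≤ (s≤s (m≤m+n m a))))) ⟩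
  H m Q.+ frac a d Q.+ frac 1 d            ≃⟨ Q.+-assoc (H m) (frac a d) (frac 1 d) ⟩
  H m Q.+ (frac a d Q.+ frac 1 d)          ≃⟨ Q.+-congʳ (H m) (frac-+-same a 1 d) ⟩
  H m Q.+ frac (a + 1) d                   ≡⟨ cong (λ x → H m Q.+ frac x d) (+-comm a 1) ⟩
  H m Q.+ frac (suc a) d                   ∎
  where open Q.≤-Reasoning

H-+-≥ : ∀ m a d .{{_ : NonZero d}} → m + a ≤ d → H m Q.+ frac a d Q.≤ H (m + a)
H-+-≥ m zero    d ≤d rewrite +-identityʳ m = Q.≤-trans (Q.+-monoʳ-≤ (H m) (frac-≤ 0 d 0 1 z≤n)) (Q.≤-reflexive (Q.+-identityʳ (H m)))
H-+-≥ m (suc a) d ≤d rewrite +-suc m a = begin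
  H m Q.+ frac (suc a) d                   ≡⟨ cong (λ x → H m Q.+ frac x d) (+-comm a 1) ⟨
  H m Q.+ frac (a + 1) d                   ≃⟨ Q.+-congʳ (H m) (frac-+-same a 1 d) ⟨
  H m Q.+ (frac a d Q.+ frac 1 d)          ≃⟨ Q.+-assoc (H m) (frac a d) (frac 1 d) ⟨
  H m Q.+ frac a d Q.+ frac 1 d            ≤⟨ Q.+-mono-≤ (H-+-≥ m a d (≤-trans (n≤1+n _) ≤d)) (frac-≤ 1 d 1 (suc (m + a)) (*-monoʳ-≤ 1 ≤d)) ⟩
  H (m + a) Q.+ frac 1 (suc (m + a))       ∎
  where open Q.≤-Reasoning

H-mono-≤ : ∀ {m n} → m ≤ n → H m Q.≤ H n
H-mono-≤ {m} m≤n with m≤n⇒∃[o]m+o≡n m≤n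
... | a , refl = Q.≤-trans (Q.p≤p+q (H m) (frac a (suc (m + a)))) (H-+-≥ m a (suc (m + a)) (n≤1+n _))

-- Cut the sum into blocks of a terms: for i ≥ 1 the terms after 1/(ai) are below 1/(ai), so their
-- block adds at most 1/i.
H-*-≤ : ∀ a b → H (a * suc b) Q.≤ H a Q.+ H b
H-*-≤ a zero    = Q.≤-trans (Q.≤-reflexive-≡ (cong H (*-identityʳ a))) (Q.≤-reflexive (Q.≃-sym (Q.+-identityʳ (H a))))
H-*-≤ a (suc b) = begin
  H (a * suc (suc b))                          ≡⟨ cong H (trans (*-suc a (suc b)) (+-comm a _)) ⟩
  H (a * suc b + a)                            ≤⟨ H-+-≤ (a * suc b) a (suc (a * suc b)) ≤-refl ⟩
  H (a * suc b) Q.+ frac a (suc (a * suc b))   ≤⟨ Q.+-mono-≤ (H-*-≤ a b) (frac-≤ a (suc (a * suc b)) 1 (suc b) (≤-trans (n≤1+n _) (≤-reflexive (sym (*-identityˡ _))))) ⟩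
  H a Q.+ H b Q.+ frac 1 (suc b)               ≃⟨ Q.+-assoc (H a) (H b) (frac 1 (suc b)) ⟩
  H a Q.+ (H b Q.+ frac 1 (suc b))             ∎
  where open Q.≤-Reasoning

-- Each doubling from x to 2x adds x terms of size at least 1/(2x), hence at least 1/2.
H-2^-≥ : ∀ s .{{_ : NonZero s}} t → H s Q.+ frac t 2 Q.≤ H (2 ^ t * s)
H-2^-≥ s zero    = Q.≤-trans (Q.+-monoʳ-≤ (H s) (frac-≤ 0 2 0 1 z≤n)) (Q.≤-trans (Q.≤-reflexive (Q.+-identityʳ (H s))) (Q.≤-reflexive-≡ (cong H (sym (+-identityʳ s)))))
H-2^-≥ s (suc t) = begin
  H s Q.+ frac (suc t) 2                       ≡⟨ cong (λ x → H s Q.+ frac x 2) (+-comm t 1) ⟨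
  H s Q.+ frac (t + 1) 2                       ≃⟨ Q.+-congʳ (H s) (frac-+-same t 1 2) ⟨
  H s Q.+ (frac t 2 Q.+ frac 1 2)              ≃⟨ Q.+-assoc (H s) (frac t 2) (frac 1 2) ⟨
  H s Q.+ frac t 2 Q.+ frac 1 2                ≤⟨ Q.+-mono-≤ (H-2^-≥ s t) (frac-≤ 1 2 x (x + x) {{_}} {{x+x≢0}} (≤-reflexive (half x))) ⟩
  H x Q.+ frac x (x + x)                       ≤⟨ H-+-≥ x x (x + x) {{x+x≢0}} ≤-refl ⟩
  H (x + x)                                    ≡⟨ cong H (trans (cong (λ y → x + y) (sym (+-identityʳ x))) (sym (*-assoc 2 (2 ^ t) s))) ⟩
  H (2 ^ suc t * s)                            ∎
  where
  open Q.≤-Reasoning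
  x = 2 ^ t * s
  x+x≢0 : NonZero (x + x)
  x+x≢0 = >-nonZero (≤-trans (>-nonZero⁻¹ x {{m*n≢0 (2 ^ t) s {{m^n≢0 2 t}}}}) (m≤m+n x x))
  half : ∀ x → 1 * (x + x) ≡ x * 2
  half = solve-∀

module _ (w : ℕ) .{{_ : NonZero w}} where

  private
    k = suc w
    ratio : logY k 1 ≡ frac w (k + 1)
    ratio = logY-≥ (s≤s z≤n)
    w≤k+1 : w ≤ k + 1
    w≤k+1 = ≤-trans (n≤1+n w) (m≤m+n k 1)

  logTerm-frac : ∀ j → logTerm k 1 j ≡ frac (2 * w ^ suc (2 * j)) (suc (2 * j) * (k + 1) ^ suc (2 * j))
  logTerm-frac j = trans (cong (frac 2 (suc (2 * j)) Q.*_) (trans (cong (λ y → powQ y (suc (2 * j))) ratio) (powQ-frac w (k + 1) (suc (2 * j)))))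
    (frac-* 2 (suc (2 * j)) (w ^ suc (2 * j)) ((k + 1) ^ suc (2 * j)) {{_}} {{m^n≢0 (k + 1) (suc (2 * j))}})

  logTerm-≤ : ∀ j p q .{{_ : NonZero q}} → 2 * q ≤ p * suc (2 * j) → logTerm k 1 j Q.≤ frac p q
  logTerm-≤ j p q h = Q.≤-trans (Q.≤-reflexive-≡ (logTerm-frac j))
    (frac-≤ (2 * w ^ m) (m * (k + 1) ^ m) p q {{m*n≢0 m ((k + 1) ^ m) {{_}} {{m^n≢0 (k + 1) m}}}} (begin
      2 * w ^ m * q                ≡⟨ swap 2 (w ^ m) q ⟩
      2 * q * w ^ m                ≤⟨ *-mono-≤ h (^-monoˡ-≤ m w≤k+1) ⟩
      p * m * (k + 1) ^ m          ≡⟨ *-assoc p m _ ⟩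
      p * (m * (k + 1) ^ m)        ∎))
    where
    open ≤-Reasoning
    m = suc (2 * j)
    swap : ∀ a b c → a * b * c ≡ a * c * b
    swap = solve-∀

  -- Since y = (k-1)/(k+1) ≤ 1, the initial term is at most 2 and term j is at most 2/(2j+1) ≤ 1/j.
  logS-≤ : ∀ M → logS k 1 (suc M) Q.≤ frac 2 1 Q.+ H M
  logS-≤ zero    = Q.≤-trans (Q.+-monoʳ-≤ 0ℚᵘ (logTerm-≤ 0 2 1 ≤-refl)) (Q.≤-reflexive (Q.+-comm 0ℚᵘ (frac 2 1)))
  logS-≤ (suc M) = Q.≤-trans (Q.+-mono-≤ (logS-≤ M) (logTerm-≤ (suc M) 1 (suc M) (≤-trans (n≤1+n _) (≤-reflexive (sym (*-identityˡ _))))))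
    (Q.≤-reflexive (Q.+-assoc (frac 2 1) (H M) (frac 1 (suc M))))

  -- ((k+1)/(k−1))^(k−1) ≥ 2, so the error term has decayed below 1 after about k log₂ k steps.
  logE-≤1 : ∀ s M → 3 ≤ k → k ≤ 2 ^ s → w * s ≤ suc (2 * M) → logE k 1 M Q.≤ 1ℚᵘ
  logE-≤1 s M 3≤k k≤2^s ws≤m = Q.≤-trans (Q.≤-reflexive-≡ (logE-frac k 1 w (∣logY∣-≥ {k} {1} (s≤s z≤n)) M))
    (frac-≤ ((k + 1) ^ 2 * w ^ m) (2 * k * 1 * (k + 1) ^ m) 1 1 {{m*n≢0 (2 * k * 1) ((k + 1) ^ m) {{_}} {{m^n≢0 (k + 1) m}}}} (begin
      (k + 1) ^ 2 * w ^ m * 1                ≡⟨ *-identityʳ _ ⟩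
      (k + 1) ^ 2 * w ^ m                    ≤⟨ *-monoˡ-≤ (w ^ m) square ⟩
      2 * k * k * w ^ m                      ≡⟨ *-assoc (2 * k) k (w ^ m) ⟩
      2 * k * (k * w ^ m)                    ≤⟨ *-monoʳ-≤ (2 * k) decay ⟩
      2 * k * (k + 1) ^ m                    ≡⟨ unit (2 * k) ((k + 1) ^ m) ⟩
      1 * (2 * k * 1 * (k + 1) ^ m)          ∎))
    where
    open ≤-Reasoning
    m = suc (2 * M)
    unit : ∀ a b → a * b ≡ 1 * (a * 1 * b)
    unit = solve-∀
    square : (k + 1) ^ 2 ≤ 2 * k * k
    square with m≤n⇒∃[o]m+o≡n 3≤k
    ... | d , eq = subst (λ k → (k + 1) ^ 2 ≤ 2 * k * k) eq (≤-trans (m≤m+n _ (2 + 4 * d + d * d)) (≤-reflexive (expand d)))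
      where
      expand : ∀ d → (3 + d + 1) * ((3 + d + 1) * 1) + (2 + 4 * d + d * d) ≡ 2 * (3 + d) * (3 + d)
      expand = solve-∀
    halves : ∀ s → 2 ^ s * w ^ (w * s) ≤ (k + 1) ^ (w * s)
    halves s = begin
      2 ^ s * w ^ (w * s)        ≡⟨ cong (2 ^ s *_) (^-*-assoc w w s) ⟨
      2 ^ s * (w ^ w) ^ s        ≡⟨ ^-distrib-* 2 (w ^ w) s ⟨
      (2 * w ^ w) ^ s            ≤⟨ ^-monoˡ-≤ s (≤-trans (double-power w (>-nonZero⁻¹ w)) (^-monoˡ-≤ w (m≤m+n k 1))) ⟩
      ((k + 1) ^ w) ^ s          ≡⟨ ^-*-assoc (k + 1) w s ⟩
      (k + 1) ^ (w * s)          ∎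
    decay : k * w ^ m ≤ (k + 1) ^ m
    decay with m≤n⇒∃[o]m+o≡n ws≤m
    ... | d , eq = begin
      k * w ^ m                              ≤⟨ *-monoˡ-≤ (w ^ m) k≤2^s ⟩
      2 ^ s * w ^ m                          ≡⟨ cong (λ m → 2 ^ s * w ^ m) eq ⟨
      2 ^ s * w ^ (w * s + d)                ≡⟨ cong (2 ^ s *_) (^-distribˡ-+-* w (w * s) d) ⟩
      2 ^ s * (w ^ (w * s) * w ^ d)          ≡⟨ *-assoc (2 ^ s) _ _ ⟨
      2 ^ s * w ^ (w * s) * w ^ d            ≤⟨ *-mono-≤ (halves s) (^-monoˡ-≤ d w≤k+1) ⟩
      (k + 1) ^ (w * s) * (k + 1) ^ d        ≡⟨ ^-distribˡ-+-* (k + 1) (w * s) d ⟨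
      (k + 1) ^ (w * s + d)                  ≡⟨ cong ((k + 1) ^_) eq ⟩
      (k + 1) ^ m                            ∎

-- With s = 6 + m this is (s + 1)² ≤ 2^s, which fails at s = 5.
sq≤2^ : ∀ m → (7 + m) * (7 + m) ≤ 2 ^ (6 + m)
sq≤2^ zero    = ≤ᵇ⇒≤ 49 64 _
sq≤2^ (suc m) = ≤-trans (≤-trans (m≤m+n _ (34 + 12 * m + m * m)) (≤-reflexive (expand m))) (*-monoʳ-≤ 2 (sq≤2^ m))
  where
  expand : ∀ m → (8 + m) * (8 + m) + (34 + 12 * m + m * m) ≡ 2 * ((7 + m) * (7 + m))
  expand = solve-∀

-- This is (C + 6)C for C = 2^(t+1), so that s = ⌊k/C⌋ ≥ C + 6. Then k < (s + 1)C ≤ (s + 1)² ≤ 2^s,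
-- where the last step uses s ≥ 6.
largeFrom : ℕ → ℕ
largeFrom t = (2 * 2 ^ t + 6) * (2 * 2 ^ t)

-- With J = ⌊k/2⌋ and k ≤ 2^s, about J s terms of the series give log k ≤ 3 + H_{Js} ≤ 3 + H_J + H_s.  A sharp
-- choice of s is not needed: s = ⌊k/C⌋ with C = 2^(t+1) makes H_J − H_s ≥ t/2.
logU-harmonic : ∀ t k → largeFrom t ≤ k →
  ∃ λ N → logU k 1 N Q.+ frac t 2 Q.≤ frac 3 1 Q.+ (H (k / 2) Q.+ H (k / 2))
logU-harmonic t k large = suc M , (begin
  S Q.+ E Q.+ frac t 2                                           ≤⟨ Q.+-monoˡ-≤ (frac t 2) (Q.+-mono-≤ (logS-part k 2≤k) (logE-part k 3≤k k≤2^s ws≤)) ⟩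
  frac 2 1 Q.+ H M Q.+ 1ℚᵘ Q.+ frac t 2                          ≤⟨ Q.+-monoˡ-≤ (frac t 2) (Q.+-monoˡ-≤ 1ℚᵘ (Q.+-monoʳ-≤ (frac 2 1) HM)) ⟩
  frac 2 1 Q.+ (H J Q.+ H s) Q.+ 1ℚᵘ Q.+ frac t 2                ≃⟨ regroup (H J) (H s) (frac t 2) ⟩
  frac 3 1 Q.+ (H J Q.+ (H s Q.+ frac t 2))                      ≤⟨ Q.+-monoʳ-≤ (frac 3 1) (Q.+-monoʳ-≤ (H J) (Q.≤-trans (H-2^-≥ s {{s≢0}} t) (H-mono-≤ Cs≤J))) ⟩
  frac 3 1 Q.+ (H J Q.+ H J)                                     ∎)
  where
  open Q.≤-Reasoning
  C = 2 * 2 ^ t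
  C≢0 : NonZero C
  C≢0 = m*n≢0 2 (2 ^ t) {{_}} {{m^n≢0 2 t}}
  s = (k / C) {{C≢0}}
  J = k / 2
  M = J * s
  S = logS k 1 (suc M)
  E = logE k 1 (suc M)
  C+6≤s : C + 6 ≤ s
  C+6≤s = ≤-trans (≤-reflexive (sym (m*n/n≡m (C + 6) C {{C≢0}}))) (/-mono-≤ {o = C} {{C≢0}} {{C≢0}} large (≤-refl {C}))
  6≤s : 6 ≤ s
  6≤s = ≤-trans (m≤n+m 6 C) C+6≤s
  s≤k : s ≤ k
  s≤k = m/n≤m k C {{C≢0}}
  3≤k : 3 ≤ k
  3≤k = ≤-trans (≤-trans (s≤s (s≤s (s≤s z≤n))) 6≤s) s≤k
  2≤k : 2 ≤ k
  2≤k = ≤-trans (n≤1+n 2) 3≤k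
  s≢0 : NonZero s
  s≢0 = >-nonZero (≤-trans (s≤s z≤n) 6≤s)
  k≤2^s : k ≤ 2 ^ s
  k≤2^s with m≤n⇒∃[o]m+o≡n 6≤s
  ... | d , eq = ≤-trans (<⇒≤ (m<suc[m/n]*n k C {{C≢0}}))
    (≤-trans (*-monoʳ-≤ (suc s) (≤-trans (≤-trans (m≤m+n C 6) C+6≤s) (n≤1+n s)))
    (subst (λ s → suc s * suc s ≤ 2 ^ s) eq (sq≤2^ d)))
  k≤2J+1 : k ≤ suc (J * 2)
  k≤2J+1 = ≤-pred (≤-trans (m<suc[m/n]*n k 2) (≤-reflexive refl))
  ws≤ : pred k * s ≤ suc (2 * suc M)
  ws≤ = ≤-trans (*-monoˡ-≤ s (pred-mono-≤ k≤2J+1)) (≤-trans (≤-reflexive (twice J s)) (≤-trans (*-monoʳ-≤ 2 (n≤1+n M)) (n≤1+n _)))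
    where
    twice : ∀ J s → J * 2 * s ≡ 2 * (J * s)
    twice = solve-∀
  Cs≤J : 2 ^ t * s ≤ J
  Cs≤J = ≤-trans (≤-reflexive (sym (m*n/n≡m (2 ^ t * s) 2))) (/-mono-≤ {o = 2} (≤-trans (≤-reflexive (shuffle (2 ^ t) s)) (m/n*n≤m k C {{C≢0}})) ≤-refl)
    where
    shuffle : ∀ x s → x * s * 2 ≡ s * (2 * x)
    shuffle = solve-∀
  logS-part : ∀ k → 2 ≤ k → logS k 1 (suc M) Q.≤ frac 2 1 Q.+ H M
  logS-part (suc zero) (s≤s ())
  logS-part (suc w@(suc _)) _ = logS-≤ w M
  logE-part : ∀ k → 3 ≤ k → k ≤ 2 ^ s → pred k * s ≤ suc (2 * suc M) → logE k 1 (suc M) Q.≤ 1ℚᵘ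
  logE-part (suc zero) (s≤s ())
  logE-part (suc w@(suc _)) = logE-≤1 w s (suc M)
  HM : H M Q.≤ H J Q.+ H s
  HM = Q.≤-trans (H-mono-≤ (*-monoʳ-≤ J (n≤1+n s))) (H-*-≤ J s)
  regroup : ∀ x y z → frac 2 1 Q.+ (x Q.+ y) Q.+ 1ℚᵘ Q.+ z Q.≃ frac 3 1 Q.+ (x Q.+ (y Q.+ z))
  regroup = solve 3 (λ x y z → con (frac 2 1) :+ (x :+ y) :+ con 1ℚᵘ :+ z := con (frac 3 1) :+ (x :+ (y :+ z))) Q.≃-refl
    where open +-*-Solver

-- Rounding costs at most 1 in each of the j terms, and the term q for i = 1 is absent from the
-- threshold.
boxThreshold-harmonic : ∀ q j → frac q 1 Q.* H (suc j) Q.≤ frac (boxThreshold q j + q + j) 1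
boxThreshold-harmonic q zero    = Q.≤-trans (Q.*-monoʳ-≤-nonNeg (frac q 1) (Q.≤-reflexive (Q.+-identityˡ 1ℚᵘ)))
  (Q.≤-trans (Q.≤-reflexive (Q.*-identityʳ (frac q 1))) (Q.≤-reflexive-≡ (cong (λ x → frac x 1) (sym (+-identityʳ q)))))
boxThreshold-harmonic q (suc j) = begin
  frac q 1 Q.* (H (suc j) Q.+ frac 1 i)                        ≃⟨ Q.*-distribˡ-+ (frac q 1) (H (suc j)) (frac 1 i) ⟩
  frac q 1 Q.* H (suc j) Q.+ frac q 1 Q.* frac 1 i             ≤⟨ Q.+-mono-≤ (boxThreshold-harmonic q j) (Q.≤-trans (Q.≤-reflexive-≡ (frac-* q 1 1 i)) (frac-≤ (q * 1) (1 * i) (suc d) 1 floor)) ⟩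
  frac (boxThreshold q j + q + j) 1 Q.+ frac (suc d) 1         ≃⟨ frac-+-same (boxThreshold q j + q + j) (suc d) 1 ⟩
  frac (boxThreshold q j + q + j + suc d) 1                    ≡⟨ cong (λ x → frac x 1) (shuffle (boxThreshold q j) q j d) ⟩
  frac (d + boxThreshold q j + q + suc j) 1                    ∎
  where
  open Q.≤-Reasoning
  i = suc (suc j)
  d = suc q / i
  floor : q * 1 * 1 ≤ suc d * (1 * i)
  floor = ≤-trans (≤-reflexive (trans (*-identityʳ _) (*-identityʳ q))) (≤-trans (≤-trans (n≤1+n q) (<⇒≤ (m<suc[m/n]*n (suc q) i))) (≤-reflexive (cong (suc d *_) (sym (*-identityˡ i)))))
  shuffle : ∀ h q j d → h + q + j + suc d ≡ d + h + q + suc j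
  shuffle = solve-∀

boxThreshold-≤ : ∀ q j → boxThreshold q j ≤ j * suc q
boxThreshold-≤ q zero    = z≤n
boxThreshold-≤ q (suc j) = +-mono-≤ (m/n≤m (suc q) (suc (suc j))) (boxThreshold-≤ q j)

boxThreshold-large : ∀ n k q j N → suc j ≤ k → k * (k * k + k) < n →
  frac (4 * n) 1 Q.≤ frac (k * q) 1 Q.* logU k 1 N →
  logU k 1 N Q.+ frac 7 1 Q.≤ frac 3 1 Q.+ (H (suc j) Q.+ H (suc j)) →
  2 * n ≤ k * boxThreshold q j
boxThreshold-large n k q j N j<k n-large 4n≤ U≤ = goal
  where
  h = boxThreshold q j
  U = logU k 1 N
  X = H (suc j)
  U+4≤ : U Q.+ frac 4 1 Q.≤ X Q.+ X
  U+4≤ = Q.≤-trans (Q.≤-reflexive (Q.≃-sym (shift U))) (Q.≤-trans (Q.+-monoˡ-≤ (Q.- frac 3 1) U≤) (Q.≤-reflexive (cancel (X Q.+ X))))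
    where
    open +-*-Solver
    shift : ∀ u → u Q.+ frac 7 1 Q.+ Q.- frac 3 1 Q.≃ u Q.+ frac 4 1
    shift = solve 1 (λ u → u :+ con (frac 7 1) :+ (:- con (frac 3 1)) := u :+ con (frac 4 1)) Q.≃-refl
    cancel : ∀ u → frac 3 1 Q.+ u Q.+ Q.- frac 3 1 Q.≃ u
    cancel = solve 1 (λ u → con (frac 3 1) :+ u :+ (:- con (frac 3 1)) := u) Q.≃-refl
  scaled : frac (4 * n + k * q * 4) 1 Q.≤ frac (k * (h + q + j) + k * (h + q + j)) 1
  scaled = begin
    frac (4 * n + k * q * 4) 1                              ≃⟨ frac-+-same (4 * n) (k * q * 4) 1 ⟨
    frac (4 * n) 1 Q.+ frac (k * q * 4) 1                   ≤⟨ Q.+-mono-≤ 4n≤ (Q.≤-reflexive-≡ (sym (frac-* (k * q) 1 4 1))) ⟩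
    frac (k * q) 1 Q.* U Q.+ frac (k * q) 1 Q.* frac 4 1    ≃⟨ Q.*-distribˡ-+ (frac (k * q) 1) U (frac 4 1) ⟨
    frac (k * q) 1 Q.* (U Q.+ frac 4 1)                     ≤⟨ Q.*-monoʳ-≤-nonNeg (frac (k * q) 1) U+4≤ ⟩
    frac (k * q) 1 Q.* (X Q.+ X)                            ≃⟨ Q.*-distribˡ-+ (frac (k * q) 1) X X ⟩
    frac (k * q) 1 Q.* X Q.+ frac (k * q) 1 Q.* X           ≤⟨ Q.+-mono-≤ one one ⟩
    frac (k * (h + q + j)) 1 Q.+ frac (k * (h + q + j)) 1   ≃⟨ frac-+-same (k * (h + q + j)) (k * (h + q + j)) 1 ⟩
    frac (k * (h + q + j) + k * (h + q + j)) 1              ∎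
    where
    open Q.≤-Reasoning
    one : frac (k * q) 1 Q.* X Q.≤ frac (k * (h + q + j)) 1
    one = begin
      frac (k * q) 1 Q.* X                     ≡⟨ cong (Q._* X) (frac-* k 1 q 1) ⟨
      frac k 1 Q.* frac q 1 Q.* X              ≃⟨ Q.*-assoc (frac k 1) (frac q 1) X ⟩
      frac k 1 Q.* (frac q 1 Q.* X)            ≤⟨ Q.*-monoʳ-≤-nonNeg (frac k 1) (boxThreshold-harmonic q j) ⟩
      frac k 1 Q.* frac (h + q + j) 1          ≡⟨ frac-* k 1 (h + q + j) 1 ⟩
      frac (k * (h + q + j)) 1                 ∎
  open ≤-Reasoning
  2n+kq≤ : 2 * n + k * q ≤ k * (h + j)
  2n+kq≤ = +-cancelʳ-≤ (k * q) _ _ (*-cancelˡ-≤ 2 (begin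
    2 * (2 * n + k * q + k * q)                     ≡⟨ left n (k * q) ⟩
    (4 * n + k * q * 4) * 1                         ≤⟨ frac-≤⁻ (4 * n + k * q * 4) 1 (k * (h + q + j) + k * (h + q + j)) 1 scaled ⟩
    (k * (h + q + j) + k * (h + q + j)) * 1         ≡⟨ right k h q j ⟩
    2 * (k * (h + j) + k * q)                       ∎))
    where
    left : ∀ n x → 2 * (2 * n + x + x) ≡ (4 * n + x * 4) * 1
    left = solve-∀
    right : ∀ k h q j → (k * (h + q + j) + k * (h + q + j)) * 1 ≡ 2 * (k * (h + j) + k * q)
    right = solve-∀
  j≤k : j ≤ k
  j≤k = <⇒≤ j<k
  j≤q : j ≤ q
  -- If q < j, then h ≤ j(q + 1) ≤ k², which caps n at k(k² + k).
  j≤q with j ≤? q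
  ... | yes p = p
  ... | no ¬p = contradiction (begin-strict
    k * (k * k + k)        <⟨ n-large ⟩
    n                      ≤⟨ m≤m+n n (n + 0) ⟩
    2 * n                  ≤⟨ m≤m+n (2 * n) (k * q) ⟩
    2 * n + k * q          ≤⟨ 2n+kq≤ ⟩
    k * (h + j)            ≤⟨ *-monoʳ-≤ k (+-mono-≤ (≤-trans (boxThreshold-≤ q j) (*-mono-≤ j≤k (≤-trans (≰⇒> ¬p) j≤k))) j≤k) ⟩
    k * (k * k + k)        ∎) (<-irrefl refl)
  goal : 2 * n ≤ k * h
  goal = +-cancelʳ-≤ (k * q) _ _ (begin
    2 * n + k * q          ≤⟨ 2n+kq≤ ⟩
    k * (h + j)            ≡⟨ *-distribˡ-+ k h j ⟩
    k * h + k * j          ≤⟨ +-monoʳ-≤ (k * h) (*-monoʳ-≤ k j≤q) ⟩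
    k * h + k * q          ∎)

-- K₀ is about 2³⁰ and must not be unfolded.
abstract
  K₀ : ℕ
  -- The choice t = 14 gives t/2 = 7 = 3 + 4: the 3 cancels the constant in the bound on the
  -- logarithm, and the 4 is what `boxThreshold-large` consumes.
  K₀ = largeFrom 14

  logU-large : ∀ k → K₀ ≤ k → ∃ λ N → logU k 1 N Q.+ frac 14 2 Q.≤ frac 3 1 Q.+ (H (k / 2) Q.+ H (k / 2))
  logU-large = logU-harmonic 14

-- The function α and the two halves of the theorem

α : ℕ → ℚᵘ
α k with K₀ ≤? k
... | yes _ = frac 1 (suc k)
... | no  _ = frac (suc (k * k)) 1

-- This uniform bound supplies Client's margin in both ranges of k.
α-≥ : ∀ k → frac 1 (suc k) Q.≤ α k
α-≥ k with K₀ ≤? k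
... | yes _ = Q.≤-refl
... | no  _ = frac-≤ 1 (suc k) (suc (k * k)) 1 (*-mono-≤ (s≤s (z≤n {k * k})) (s≤s (z≤n {k})))

α-positive : ∀ k → 0ℚᵘ Q.< α k
α-positive k = Q.<-≤-trans (frac-< 0 1 1 (suc k) (s≤s z≤n)) (α-≥ k)

α-vanishes : ∀ ε → 0ℚᵘ Q.< ε → Σ ℕ λ K → ∀ k → K ≤ k → α k Q.< ε
α-vanishes (mkℚᵘ (ℤ.+ zero)  d) (*<* (+<+ ()))
α-vanishes (mkℚᵘ (ℤ.+ suc p) d) _ = K₀ + suc d , small
  where
  small : ∀ k → K₀ + suc d ≤ k → α k Q.< frac (suc p) (suc d)
  small k K≤k with K₀ ≤? k
  ... | no  K₀≰k = contradiction (≤-trans (m≤m+n K₀ (suc d)) K≤k) K₀≰k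
  ... | yes _    = frac-< 1 (suc k) (suc p) (suc d)
    (≤-trans (s≤s (≤-trans (≤-reflexive (*-identityˡ (suc d))) (≤-trans (m≤n+m (suc d) K₀) K≤k))) (m≤n*m (suc k) (suc p)))
α-vanishes (mkℚᵘ ℤ.-[1+ _ ] d) (*<* ())

-- As U_0 ≤ k/2, the hypothesis gives 2(k² + 5)n ≤ k²q, so q ≥ 2n. Two boxes with at most n edges
-- each then suffice: the threshold ⌊(q+1)/2⌋ is at least n.
waiter-small : ∀ n k q → 2 ≤ k → frac ((4 + suc (k * k)) * n) 1 Q.≤ frac (k * q) 1 Q.* logU k 1 0 → WaiterCanEnsure n q (Colorable k)
waiter-small n k@(suc _) q 2≤k le = waiterColors {r = n} 2≤k (m<m*n′ n (k ∸ 2)) (begin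
  n                               ≡⟨ m*n/n≡m n 2 ⟨
  n * 2 / 2                       ≤⟨ /-mono-≤ {o = 2} 2n≤q ≤-refl ⟩
  suc q / 2                       ≤⟨ m≤m+n (suc q / 2) 0 ⟩
  suc q / 2 + 0                   ∎)
  where
  open ≤-Reasoning
  m<m*n′ : ∀ n x → n < suc n * suc x
  m<m*n′ n x = m≤m*n (suc n) (suc x)
  U≤ : logU k 1 0 Q.≤ frac k 2
  U≤ = logU₀-≤ {k} {1} k (s≤s z≤n) (≤-reflexive (sym (*-identityʳ k)))
  bound : (4 + suc (k * k)) * n * (1 * 2) ≤ k * q * k * 1
  bound = frac-≤⁻ ((4 + suc (k * k)) * n) 1 (k * q * k) (1 * 2)
    (Q.≤-trans le (Q.≤-trans (Q.*-monoʳ-≤-nonNeg (frac (k * q) 1) U≤) (Q.≤-reflexive-≡ (frac-* (k * q) 1 k 2))))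
  2n≤q : n * 2 ≤ suc q
  2n≤q = ≤-trans (*-cancelˡ-≤ (k * k) (begin
    k * k * (n * 2)                      ≤⟨ m≤n+m _ (5 * (n * 2)) ⟩
    5 * (n * 2) + k * k * (n * 2)        ≡⟨ left (k * k) n ⟩
    (4 + suc (k * k)) * n * (1 * 2)      ≤⟨ bound ⟩
    k * q * k * 1                        ≡⟨ right k q ⟩
    k * k * q                            ∎)) (n≤1+n q)
    where
    left : ∀ x n → 5 * (n * 2) + x * (n * 2) ≡ (4 + suc x) * n * (1 * 2)
    left = solve-∀
    right : ∀ k q → k * q * k * 1 ≡ k * k * q
    right = solve-∀

waiter-large : ∀ n k q j N → k / 2 ≡ suc j → 2 ≤ k → k * (k * k + k) < n →
  frac (4 * n) 1 Q.≤ frac (k * q) 1 Q.* logU k 1 N →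
  logU k 1 N Q.+ frac 7 1 Q.≤ frac 3 1 Q.+ (H (suc j) Q.+ H (suc j)) →
  WaiterCanEnsure n q (Colorable k)
waiter-large n k@(suc _) q j N J≡ 2≤k n-large 4n≤ U≤ = waiterColors {r = r} j<k boxes threshold
  where
  open ≤-Reasoning
  r = 2 * n / k
  2J≤k : suc j * 2 ≤ k
  2J≤k = ≤-trans (≤-reflexive (cong (_* 2) (sym J≡))) (m/n*n≤m k 2)
  j<k : suc j ≤ k
  j<k = ≤-trans (m≤m*n (suc j) 2) 2J≤k
  k≤ : k ≤ suc (k ∸ suc j) * 2
  k≤ = +-cancelʳ-≤ (suc j * 2) _ _ (begin
    k + suc j * 2                             ≤⟨ +-monoʳ-≤ k 2J≤k ⟩
    k + k                                     ≡⟨ cong₂ _+_ (sym eq) (sym eq) ⟩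
    (d + suc j) + (d + suc j)                 ≤⟨ m≤m+n _ 2 ⟩
    (d + suc j) + (d + suc j) + 2             ≡⟨ collect d j ⟩
    suc d * 2 + suc j * 2                     ∎)
    where
    d = k ∸ suc j
    eq : d + suc j ≡ k
    eq = m∸n+n≡m j<k
    collect : ∀ d j → (d + suc j) + (d + suc j) + 2 ≡ suc d * 2 + suc j * 2
    collect = solve-∀
  boxes : n < suc r * suc (k ∸ suc j)
  boxes = *-cancelˡ-< 2 _ _ (begin-strict
    2 * n                                     <⟨ m<suc[m/n]*n (2 * n) k ⟩
    suc r * k                                 ≤⟨ *-monoʳ-≤ (suc r) k≤ ⟩
    suc r * (suc (k ∸ suc j) * 2)             ≡⟨ shuffle (suc r) (suc (k ∸ suc j)) ⟩
    2 * (suc r * suc (k ∸ suc j))             ∎)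
    where
    shuffle : ∀ a b → a * (b * 2) ≡ 2 * (a * b)
    shuffle = solve-∀
  threshold : r ≤ boxThreshold q j
  threshold = *-cancelʳ-≤ _ _ k (begin
    r * k                                     ≤⟨ m/n*n≤m (2 * n) k ⟩
    2 * n                                     ≤⟨ boxThreshold-large n k q j N j<k n-large 4n≤ U≤ ⟩
    k * boxThreshold q j                      ≡⟨ *-comm k _ ⟩
    boxThreshold q j * k                      ∎)

waiterSide : ∀ n k q → 2 ≤ k → k * (k * k + k) < n → LeMulLog ((ℕ→Q 4 Q.+ α k) Q.* ℕ→Q n) (ℕ→Q (k * q)) k 1 →
  WaiterCanEnsure n q (Colorable k)
waiterSide n k q 2≤k n-large le with K₀ ≤? k
... | no _ = waiter-small n k q 2≤k (Q.≤-trans (Q.≤-reflexive (Q.≃-sym lhs)) (Q.≮⇒≥ λ lt → le (0 , lt)))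
  where
  lhs : (ℕ→Q 4 Q.+ frac (suc (k * k)) 1) Q.* ℕ→Q n Q.≃ frac ((4 + suc (k * k)) * n) 1
  lhs = Q.≃-trans (Q.*-congʳ {x = ℕ→Q n} (frac-+-same 4 (suc (k * k)) 1)) (Q.≃-reflexive (frac-* (4 + suc (k * k)) 1 n 1))
... | yes K₀≤k with k / 2 in J≡ | logU-large k K₀≤k
... | zero | _ = contradiction (≤-trans (≤-reflexive (sym (m*n/n≡m 1 2))) (≤-trans (/-mono-≤ {o = 2} 2≤k ≤-refl) (≤-reflexive J≡))) λ ()
... | suc j | N , U≤ = waiter-large n k q j N J≡ 2≤k n-large
  (Q.≤-trans (Q.≤-reflexive-≡ (sym (frac-* 4 1 n 1))) (Q.≤-trans (Q.*-monoˡ-≤-nonNeg (ℕ→Q n) (Q.p≤p+q (ℕ→Q 4) (frac 1 (suc k)))) (Q.≮⇒≥ λ lt → le (N , lt))))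
  (Q.≤-trans (Q.+-monoʳ-≤ (logU k 1 N) (frac-≤ 7 1 14 2 ≤-refl)) U≤)

-- The logarithm here is n log 2 - 2qk log k, so the hypothesis is q ≤ (log 2/2 - α)n/(k log k) with
-- denominators cleared. Since 2αn ≥ 2n/(k+1) > 2^k, `exp-bound` applies.
clientSide : ∀ n k q → 2 ≤ k → 1 ≤ q → suc k * 2 ^ k ≤ n →
  LeMulLog (ℕ→Q 2 Q.* α k Q.* ℕ→Q n) (ℕ→Q 1) (2 ^ n) (k ^ (2 * q * k)) →
  ClientCanEnsure n q (λ G → ¬ Colorable k G)
clientSide n k@(suc _) q 2≤k 1≤q n-large le = clientSpoils n k q (≤-trans (>-nonZero⁻¹ (suc k * 2 ^ k) {{m*n≢0 (suc k) (2 ^ k) {{_}} {{m^n≢0 2 k}}}}) n-large) (s≤s z≤n) 1≤q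
  (exp-bound k {{m^n≢0 2 n}} {{m^n≢0 k (2 * q * k)}} 2^k< le)
  where
  2^k< : frac (2 ^ k) 1 Q.< ℕ→Q 2 Q.* α k Q.* ℕ→Q n
  2^k< = Q.<-≤-trans (frac-< (2 ^ k) 1 (2 * 1 * n) (1 * suc k * 1) bound)
    (Q.≤-trans (Q.≤-reflexive-≡ (sym (trans (cong (Q._* ℕ→Q n) (frac-* 2 1 1 (suc k))) (frac-* (2 * 1) (1 * suc k) n 1))))
      (Q.*-monoˡ-≤-nonNeg (ℕ→Q n) (Q.*-monoʳ-≤-nonNeg (ℕ→Q 2) (α-≥ k))))
    where
    open ≤-Reasoning
    n>0 : 0 < n
    n>0 = ≤-trans (>-nonZero⁻¹ (suc k * 2 ^ k) {{m*n≢0 (suc k) (2 ^ k) {{_}} {{m^n≢0 2 k}}}}) n-large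
    left : ∀ x k → x * (1 * suc k * 1) ≡ suc k * x
    left = solve-∀
    bound : 2 ^ k * (1 * suc k * 1) < 2 * 1 * n * 1
    bound = begin-strict
      2 ^ k * (1 * suc k * 1)    ≡⟨ left (2 ^ k) k ⟩
      suc k * 2 ^ k              ≤⟨ n-large ⟩
      n                          <⟨ m<m+n n n>0 ⟩
      n + n                      ≡⟨ double n ⟩
      2 * 1 * n * 1              ∎
      where
      double : ∀ n → n + n ≡ 2 * 1 * n * 1
      double = solve-∀

theorem1p7 : Σ (ℕ → ℚᵘ) λ α →
    (∀ k → 0ℚᵘ <ℚ α k) ×
    (∀ ε → 0ℚᵘ <ℚ ε → Σ ℕ λ K → ∀ k → K ≤ k → α k <ℚ ε) ×
    (∀ k → 2 ≤ k → Σ ℕ λ n₀ → ∀ n → n₀ ≤ n →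
    ((q : ℕ) →
    LeMulLog ((ℕ→Q 4 +ℚ α k) *ℚ ℕ→Q n) (ℕ→Q (k * q)) k 1 →
    WaiterCanEnsure n q (Colorable k)) ×
    ((q : ℕ) → 1 ≤ q →
    LeMulLog (ℕ→Q 2 *ℚ α k *ℚ ℕ→Q n) (ℕ→Q 1) (2 ^ n) (k ^ (2 * q * k)) →
    ClientCanEnsure n q (λ G → ¬ Colorable k G)))
theorem1p7 = α , α-positive , α-vanishes , λ k 2≤k →
  -- The first summand yields j ≤ q in Waiter's half for k ≥ `K₀`; the second makes 2αn exceed 2^k
  -- in Client's half.
  suc (k * (k * k + k)) + suc k * 2 ^ k , λ n n₀≤n →
    (λ q → waiterSide n k q 2≤k (≤-trans (m≤m+n _ _) n₀≤n)) ,
    (λ q 1≤q → clientSide n k q 2≤k 1≤q (≤-trans (m≤n+m _ (suc (k * (k * k + k)))) n₀≤n))
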